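{- Let $\mathcal{H}$ be a finite nonempty family of tournaments. If $\mathcal{H}$ has the $(\mathcal{F},v,\eta)$-strong EH-property (for some $v,\eta,\mathcal{F}$), then $\mathcal{H}$ has the EH-property.
   Context: Tournaments are finite; a subtournament is an induced subtournament on a subset of vertices; a tournament is transitive if it has no directed cycle. For a tournament $T$, $tr(T)$ is the maximum size of a transitive subtournament of $T$. A set $V_1$ is complete to $V_2$ if every vertex of $V_1$ is adjacent to (has an edge to) every vertex of $V_2$. For disjoint nonempty $X,Y\subseteq V(T)$, $d(X,Y)=e_{X,Y}/(|X||Y|)$ where $e_{X,Y}$ is the number of edges $(x,y)$ with $x\in X,y\in Y$. For a $\{0,1\}$-vector $v$ of length $m$, let $\zeta^v(i)=|\{j\le i: v(j)=1\}|$. Let $\eta$ be a vector of positive integers of length $\zeta^v(m)$ and $k=|\{j:v(j)=0\}|+\sum_i \eta(i)$. For a tournament $T$, $c>0$, $0\le\lambda<1$, a $(v,\eta,c,\lambda)$-m-sequence in $T$ is a sequence $\chi=(S_1,\dots,S_m)$ of pairwise disjoint subsets of $V(T)$ such that: if $v(i)=1$ then $S_i$ induces a transitive subtournament and is partitioned into $\eta(\zeta^v(i))$ sets $S_{i,1},\dots,S_{i,\eta(\zeta^v(i))}$ with $S_{i,a}$ complete to $S_{i,b}$ for $a<b$ and $|S_{i,a}|\ge c\,tr(T)$ for all $a$; if $v(i)=0$ then $|S_i|\ge c|T|$; and $d(S_i,S_j)\ge 1-\lambda$ for all $i<j$. Its long representation $l(\chi)=(T_1,\dots,T_k)$ is obtained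 from $\chi$ by replacing each $S_i$ with $v(i)=1$ by $S_{i,1},\dots,S_{i,\eta(\zeta^v(i))}$ in this order; $V(\chi)=\bigcup S_i$. A $c'$-strong pair in $\chi$ is a pair $(A,B)$ of disjoint subsets of $V(\chi)$ with $|A|\ge c'|T|$, such that either $|B|\ge c'|T|$ or ($B$ induces a transitive subtournament and $|B|\ge c'\,tr(T)$), and such that $d(A,B)=1$ or $d(B,A)=1$. Let $\mathcal{H}=\{H_1,\dots,H_t\}$ be a finite family of tournaments with $V(H_i)=\{h^i_1,\dots,h^i_{|H_i|}\}$, and $\mathcal{F}=\{f_1,\dots,f_t\}$ with $f_i:V(H_i)\to\{1,\dots,k\}$ injective. $\mathcal{H}$ has the $(\mathcal{F},v,\eta)$-strong EH-property if for every $c_1>0$ there exist $\lambda_0>0$ and $c_2>0$ such that for every tournament $T$, every $0\le\lambda\le\lambda_0$ and every $(v,\eta,c_1,\lambda)$-m-sequence $\chi$ in $T$ with $l(\chi)=(T_1,\dots,T_k)$, either (i) there exist $i$ and vertices $x_1,\dots,x_{|H_i|}$ with $x_j\in T_{f_i(h^i_j)}$ such that $x_j\mapsto h^i_j$ is an isomorphism from the subtournament induced on $\{x_1,\dots,x_{|H_i|}\}$ onto $H_i$, or (ii) $\chi$ contains a $c_2$-strong pair. A finite family $\mathcal{H}$ has the EH-property if there is $\epsilon>0$ such that every tournament $T$ containing no member of $\mathcal{H}$ as a subtournament contains a transitive subtournament on at least $|T|^{\epsilon}$ vertices. -}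

module Defs where

open import Data.Nat as ℕ using (ℕ; zero; suc; _+_; _∸_)
open import Data.Fin using (Fin)
open import Data.Fin.Subset using (Subset; _∈_; ∣_∣; ⊥)
open import Data.Bool as B using (Bool; true; false; not; if_then_else_; _∧_)
open import Data.Vec using (lookup)
open import Data.List using (List; []; _∷_; concat; map; allFin; upTo)
open import Data.Nat.ListAction using (sum)
open import Data.Product using (Σ; _×_; _,_)
open import Data.Sum using (_⊎_)
open import Data.Integer using (+_)
open import Data.Rational using (ℚ; _/_; 0ℚ; 1ℚ; _*_; _-_)
  renaming (_≤_ to _≤ℚ_)
open import Relation.Binary.PropositionalEquality using (_≡_; _≢_)
open import Relation.Nullary using (¬_)
open import Function.Definitions using (Injective)
import Data.Empty as E

-- Tournaments on vertex set Fin size; adj x y = true means edge x → y.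

record Tour : Set where
  field
    size   : ℕ
    adj    : Fin size → Fin size → Bool
    irrefl : ∀ x → adj x x ≡ false
    tourn  : ∀ x y → x ≢ y → adj y x ≡ not (adj x y)

open Tour public

V : Tour → Set
V T = Fin (size T)

VSet : Tour → Set
VSet T = Subset (size T)

Edge : (T : Tour) → V T → V T → Set
Edge T x y = B.T (adj T x y)

ℕ→ℚ : ℕ → ℚ
ℕ→ℚ n = (+ n) / 1

InRange : ℕ → ℕ → Set
InRange n i = 1 ℕ.≤ i × i ℕ.≤ n

sumTo : (ℕ → ℕ) → ℕ → ℕ
sumTo f zero = 0
sumTo f (suc n) = sumTo f n + f (suc n)

range1 : ℕ → List ℕ
range1 n = map suc (upTo n)

lookupD : {A : Set} → List A → ℕ → A → A
lookupD [] _ d = d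
lookupD (x ∷ xs) zero d = x
lookupD (x ∷ xs) (suc i) d = lookupD xs i d

HasCycleIn : (T : Tour) → VSet T → Set
HasCycleIn T S =
  Σ ℕ λ k → Σ (ℕ → V T) λ x →
    (∀ i → i ℕ.≤ k → x i ∈ S) ×
    (∀ i j → i ℕ.≤ k → j ℕ.≤ k → x i ≡ x j → i ≡ j) ×
    (∀ i → i ℕ.< k → Edge T (x i) (x (suc i))) ×
    Edge T (x k) (x 0)

Transitive : (T : Tour) → VSet T → Set
Transitive T S = ¬ HasCycleIn T S

IsTr : Tour → ℕ → Set
IsTr T t =
  (Σ (VSet T) λ S → Transitive T S × ∣ S ∣ ≡ t) ×
  (∀ S → Transitive T S → ∣ S ∣ ℕ.≤ t)

Contains : Tour → Tour → Set
Contains T H =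
  Σ (V H → V T) λ φ → Injective _≡_ _≡_ φ ×
    (∀ a b → adj T (φ a) (φ b) ≡ adj H a b)

Disjoint : (T : Tour) → VSet T → VSet T → Set
Disjoint T X Y = ∀ x → x ∈ X → x ∈ Y → E.⊥

Complete : (T : Tour) → VSet T → VSet T → Set
Complete T X Y = ∀ x y → x ∈ X → y ∈ Y → Edge T x y

eCount : (T : Tour) → VSet T → VSet T → ℕ
eCount T X Y =
  sum (map (λ x → sum (map (λ y →
    if lookup X x ∧ lookup Y y ∧ adj T x y then 1 else 0)
    (allFin (size T)))) (allFin (size T)))

-- m-sequences.  v is a {0,1}-vector of length m, indexed 1..m (true = 1);
-- η is a vector of length ζ^v(m), indexed 1..ζ^v(m).

ζ : (ℕ → Bool) → ℕ → ℕ
ζ v i = sumTo (λ j → if v j then 1 else 0) i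

kOf : ℕ → (ℕ → Bool) → (ℕ → ℕ) → ℕ
kOf m v η = sumTo (λ j → if v j then 0 else 1) m + sumTo η (ζ v m)

-- (v,η,c,λ)-m-sequence in T, where t = tr(T).  S i is S_i and,
-- when v(i) = 1, part i a is S_{i,a}.
record MSeq (T : Tour) (t : ℕ) (m : ℕ) (v : ℕ → Bool) (η : ℕ → ℕ)
            (c lam : ℚ) : Set where
  field
    S    : ℕ → VSet T
    part : ℕ → ℕ → VSet T
    disjoint : ∀ i j → InRange m i → InRange m j → i ≢ j →
               Disjoint T (S i) (S j)
    one-transitive : ∀ i → InRange m i → v i ≡ true → Transitive T (S i)
    one-cover₁ : ∀ i → InRange m i → v i ≡ true → ∀ x → x ∈ S i →
                 Σ ℕ λ a → InRange (η (ζ v i)) a × x ∈ part i a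
    one-cover₂ : ∀ i → InRange m i → v i ≡ true → ∀ a →
                 InRange (η (ζ v i)) a → ∀ x → x ∈ part i a → x ∈ S i
    one-partsDisjoint : ∀ i → InRange m i → v i ≡ true → ∀ a b →
                 InRange (η (ζ v i)) a → InRange (η (ζ v i)) b → a ≢ b →
                 Disjoint T (part i a) (part i b)
    one-complete : ∀ i → InRange m i → v i ≡ true → ∀ a b →
                 InRange (η (ζ v i)) a → InRange (η (ζ v i)) b → a ℕ.< b →
                 Complete T (part i a) (part i b)
    one-size : ∀ i → InRange m i → v i ≡ true → ∀ a →
                 InRange (η (ζ v i)) a → c * ℕ→ℚ t ≤ℚ ℕ→ℚ ∣ part i a ∣
    zero-size : ∀ i → InRange m i → v i ≡ false →
                 c * ℕ→ℚ (size T) ≤ℚ ℕ→ℚ ∣ S i ∣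
    -- d(S_i,S_j) ≥ 1 - λ, i.e. e_{S_i,S_j} ≥ (1 - λ)|S_i||S_j|
    dense : ∀ i j → InRange m i → InRange m j → i ℕ.< j →
                 (1ℚ - lam) * ℕ→ℚ (∣ S i ∣ ℕ.* ∣ S j ∣)
                   ≤ℚ ℕ→ℚ (eCount T (S i) (S j))

module _ {T : Tour} {t m : ℕ} {v : ℕ → Bool} {η : ℕ → ℕ} {c lam : ℚ}
         (χ : MSeq T t m v η c lam) where
  open MSeq χ

  blocks : ℕ → List (VSet T)
  blocks i = if v i then map (part i) (range1 (η (ζ v i))) else (S i ∷ [])

  longRep : List (VSet T)
  longRep = concat (map blocks (range1 m))

  Tpart : ℕ → VSet T
  Tpart j = lookupD longRep (j ∸ 1) ⊥

  InVχ : V T → Set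
  InVχ x = Σ ℕ λ i → InRange m i × x ∈ S i

  StrongPair : ℚ → Set
  StrongPair c' =
    Σ (VSet T) λ A → Σ (VSet T) λ B →
      (∀ x → x ∈ A → InVχ x) × (∀ x → x ∈ B → InVχ x) × Disjoint T A B ×
      c' * ℕ→ℚ (size T) ≤ℚ ℕ→ℚ ∣ A ∣ ×
      (c' * ℕ→ℚ (size T) ≤ℚ ℕ→ℚ ∣ B ∣ ⊎
        (Transitive T B × c' * ℕ→ℚ t ≤ℚ ℕ→ℚ ∣ B ∣)) ×
      -- d(A,B) = 1 or d(B,A) = 1
      (eCount T A B ≡ ∣ A ∣ ℕ.* ∣ B ∣ ⊎ eCount T B A ≡ ∣ B ∣ ℕ.* ∣ A ∣)

  HasRainbowCopy : (nH : ℕ) → (H : Fin nH → Tour) →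
                   (F : (i : Fin nH) → V (H i) → ℕ) → Set
  HasRainbowCopy nH H F =
    Σ (Fin nH) λ i → Σ (V (H i) → V T) λ x →
      (∀ h → x h ∈ Tpart (F i h)) × Injective _≡_ _≡_ x ×
      (∀ a b → adj T (x a) (x b) ≡ adj (H i) a b)

StrongEH : (nH : ℕ) (H : Fin nH → Tour) (F : (i : Fin nH) → V (H i) → ℕ)
           (m : ℕ) (v : ℕ → Bool) (η : ℕ → ℕ) → Set
StrongEH nH H F m v η =
  ∀ c₁ → 0ℚ Data.Rational.< c₁ →
    Σ ℚ λ lam₀ → Σ ℚ λ c₂ → 0ℚ Data.Rational.< lam₀ × 0ℚ Data.Rational.< c₂ ×
      (∀ (T : Tour) (t : ℕ) → IsTr T t →
        ∀ lam → 0ℚ ≤ℚ lam → lam ≤ℚ lam₀ → lam Data.Rational.< 1ℚ →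
        (χ : MSeq T t m v η c₁ lam) →
        HasRainbowCopy χ nH H F ⊎ StrongPair χ c₂)

-- The EH-property, with ε = p / q a positive rational:
-- |T|^ε ≤ |S|  ⇔  |T|^p ≤ |S|^q
EH : (nH : ℕ) (H : Fin nH → Tour) → Set
EH nH H =
  Σ ℕ λ p → Σ ℕ λ q → 1 ℕ.≤ p × 1 ℕ.≤ q ×
    (∀ (T : Tour) → (∀ i → ¬ Contains T (H i)) →
      Σ (VSet T) λ S → Transitive T S × size T ℕ.^ p ℕ.≤ ∣ S ∣ ℕ.^ q)

{-# OPTIONS --safe #-}
module Submission where

-- Fix q large and suppose that |T| > tr(T)^q while every smaller H-free tournament U satisfies
-- |U| ≤ tr(U)^q. Then every set of linear size carries a transitive set almost as large as tr(T).
-- Greedy embedding turns H-freeness into pairs of linear sets of density close to 1, and iterating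
-- this inside the second set gives X_1, …, X_m of equal size s, together with S_i ⊆ X_i (all of X_i,
-- or a large transitive set cut into blocks), that are pairwise dense. The StrongEH hypothesis is
-- applied not to T but to T′ = T[X_1 ∪ … ∪ X_m]: relative to T′ the sets S_i have proportions that do
-- not depend on λ, as the order of quantifiers requires. A rainbow copy contradicts H-freeness; a
-- strong pair (A, B) gives transitive sets in A and in B whose union has more than tr(T) vertices.

open import Defs
import Algebra.Properties.Semiring.Sum as SemiringSum
open import Data.Bool as B using (Bool; true; false; not; if_then_else_; _∧_; _∨_; T?)
open import Data.Bool.Properties using (T-∧; T-∨; T-≡; T-not-≡)
open import Data.Empty using (⊥; ⊥-elim)
open import Data.Fin as Fin using (Fin; zero; suc; toℕ)
open import Data.Fin.Properties using (injective⇒≤; suc-injective; any?; all?; toℕ-injective; toℕ-fromℕ<; toℕ<n)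
open import Data.Fin.Subset using (_∈_; ∣_∣)
open import Data.Integer as ℤ using (+[1+_]; +≤+; +<+)
import Data.Integer.Properties as ℤ
open import Data.List as List using (List; []; _∷_; _++_; length; lookup; map; allFin)
open import Data.List.Membership.Propositional.Properties using (∈-lookup)
open import Data.List.Properties using (length-++; length-map; length-tabulate; map-tabulate)
open import Data.List.Relation.Binary.Permutation.Propositional using (_↭_; prep; swap; ↭-trans; ↭-refl; ↭-sym)
open import Data.List.Relation.Binary.Permutation.Propositional.Properties using (All-resp-↭; ↭-length)
open import Data.List.Relation.Unary.All as All using (All; []; _∷_)
import Data.List.Relation.Unary.All.Properties as All
open import Data.List.Relation.Unary.AllPairs as AllPairs using (AllPairs; []; _∷_)
import Data.List.Relation.Unary.AllPairs.Properties as AllPairs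
open import Data.Nat
import Data.Nat.Coprimality as C
open import Data.Nat.Divisibility using (n∣m*n)
open import Data.Nat.DivMod
import Data.Nat.ListAction as ListAction
open import Data.Nat.Properties hiding (suc-injective)
open import Data.Nat.Tactic.RingSolver using (solve-∀)
open import Data.Product hiding (map; swap)
open import Data.Rational as ℚ using (ℚ; mkℚ; toℚᵘ; 0ℚ; 1ℚ; *≤*; *<*)
import Data.Rational.Properties as ℚ
open import Data.Rational.Unnormalised as ℚᵘ using (mkℚᵘ) renaming (_≃_ to _≃ᵘ_; *≤* to *≤ᵘ*; *≡* to *≡ᵘ*)
import Data.Rational.Unnormalised.Properties as ℚᵘ
open import Data.Sum using (_⊎_; inj₁; inj₂; reduce) renaming (map to map⊎)
import Data.Vec as Vec
open import Data.Vec.Properties using (lookup⇒[]=; []=⇒lookup; lookup∘tabulate)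
open import Function
open import Function.Definitions using (Injective)
open import Relation.Binary.Definitions using (tri<; tri≈; tri>)
open import Relation.Binary.PropositionalEquality hiding ([_])
open import Relation.Nullary
open import Relation.Nullary.Decidable using (toWitness; fromWitness; map′; _×-dec_; ¬?; isYes)

-- The exponent is fixed last. The data m, v, η determine the proportion 1/(k + 1) handed to
-- StrongEH, which answers with λ₀ and c₂; these determine the factor E by which the sets that occur
-- may be smaller than T. In q-th roots a factor E becomes E^(1/q), so for q ≥ dE criticality gives
-- every proper subset of at least |T|/E vertices a transitive set of more than dt/(d + 1) vertices,
-- where t = tr(T). This margin decides the strong pair: A is always linear and supplies more than
-- dt/(d + 1), so B need only supply t/(d + 1). A transitive B is known only to have a constant
-- fraction of tr(T′), and d = 2d₂ + 1 is matched to that fraction, given c₂ ≥ 1/(d₂ + 1) and tr(T′)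
-- ≥ t/2. The obstacle before that point is that a transitive S_i may be far smaller than X_i, while
-- the density of a pair of linear sets says nothing about such small subsets. Density is therefore
-- made to hold vertex by vertex before S_i is chosen.

private module Sum = SemiringSum +-*-semiring

-- Boolean predicates on Fin n and counting

VPred : ℕ → Set
VPred n = Fin n → Bool

infix 4 _∈ᵇ_ _⊆ᵇ_
_∈ᵇ_ : ∀ {n} → Fin n → VPred n → Set
x ∈ᵇ P = B.T (P x)

_⊆ᵇ_ : ∀ {n} → VPred n → VPred n → Set
P ⊆ᵇ Q = ∀ x → x ∈ᵇ P → x ∈ᵇ Q

infixr 6 _∩_
_∩_ : ∀ {n} → VPred n → VPred n → VPred n
(P ∩ Q) x = P x ∧ Q x

∁ : ∀ {n} → VPred n → VPred n
∁ P x = not (P x)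

Disj : ∀ {n} → VPred n → VPred n → Set
Disj P Q = ∀ x → x ∈ᵇ P → x ∈ᵇ Q → ⊥

∧⁺ : ∀ {a b} → B.T a → B.T b → B.T (a ∧ b)
∧⁺ p q = Equivalence.from T-∧ (p , q)

∧⁻ˡ : ∀ {a b} → B.T (a ∧ b) → B.T a
∧⁻ˡ = proj₁ ∘ Equivalence.to T-∧

∧⁻ʳ : ∀ {a b} → B.T (a ∧ b) → B.T b
∧⁻ʳ {a} = proj₂ ∘ Equivalence.to (T-∧ {a})

not⁺ : ∀ {a} → ¬ B.T a → B.T (not a)
not⁺ {true}  n = n _
not⁺ {false} n = _

not⁻ : ∀ {a} → B.T (not a) → ¬ B.T a
not⁻ {false} _ ()

𝟙 : Bool → ℕ
𝟙 true  = 1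
𝟙 false = 0

𝟙-mono : ∀ {a b} → (B.T a → B.T b) → 𝟙 a ≤ 𝟙 b
𝟙-mono {false} _ = z≤n
𝟙-mono {true} {true}  f = ≤-refl
𝟙-mono {true} {false} f = ⊥-elim (f _)

𝟙-∧ : ∀ a b → 𝟙 (a ∧ b) ≡ 𝟙 a * 𝟙 b
𝟙-∧ true  b = sym (*-identityˡ (𝟙 b))
𝟙-∧ false b = refl

-- Opaque, so that unification treats sum as rigid.
opaque
  sum : ∀ {n} → (Fin n → ℕ) → ℕ
  sum = Sum.sum

  sum-cong : ∀ {n} {f g : Fin n → ℕ} → (∀ i → f i ≡ g i) → sum f ≡ sum g
  sum-cong = Sum.sum-cong-≗

  sum-+ : ∀ {n} (f g : Fin n → ℕ) → sum (λ i → f i + g i) ≡ sum f + sum g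
  sum-+ = Sum.∑-distrib-+

  sum-comm : ∀ {m n} (f : Fin m → Fin n → ℕ) →
             sum (λ i → sum (f i)) ≡ sum (λ j → sum (λ i → f i j))
  sum-comm = Sum.∑-comm

  *-distribˡ-sum : ∀ {n} c (f : Fin n → ℕ) → c * sum f ≡ sum (λ i → c * f i)
  *-distribˡ-sum = Sum.*-distribˡ-sum

  *-distribʳ-sum : ∀ {n} c (f : Fin n → ℕ) → sum f * c ≡ sum (λ i → f i * c)
  *-distribʳ-sum = Sum.*-distribʳ-sum

  sum-mono : ∀ {n} {f g : Fin n → ℕ} → (∀ i → f i ≤ g i) → sum f ≤ sum g
  sum-mono {zero}  h = z≤n
  sum-mono {suc n} h = +-mono-≤ (h zero) (sum-mono (h ∘ suc))

  sum-empty : (f : Fin 0 → ℕ) → sum f ≡ 0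
  sum-empty f = refl

  sum-suc : ∀ {n} (f : Fin (suc n) → ℕ) → sum f ≡ f zero + sum (f ∘ suc)
  sum-suc f = refl

  sum-const : ∀ n c → sum {n} (λ _ → c) ≡ n * c
  sum-const zero    c = refl
  sum-const (suc n) c = cong (c +_) (sum-const n c)

  term≤sum : ∀ {n} (f : Fin n → ℕ) i → f i ≤ sum f
  term≤sum f zero    = m≤m+n _ _
  term≤sum f (suc i) = ≤-trans (term≤sum (f ∘ suc) i) (m≤n+m _ (f zero))

sum-bound : ∀ {n} {f : Fin n → ℕ} {c} → (∀ i → f i ≤ c) → sum f ≤ n * c
sum-bound h = ≤-trans (sum-mono h) (≤-reflexive (sum-const _ _))

sum≡0⇒term≡0 : ∀ {n} (f : Fin n → ℕ) → sum f ≡ 0 → ∀ i → f i ≡ 0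
sum≡0⇒term≡0 f eq i = n≤0⇒n≡0 (≤-trans (term≤sum f i) (≤-reflexive eq))

cnt : ∀ {n} → VPred n → ℕ
cnt P = sum (λ x → 𝟙 (P x))

cnt-mono : ∀ {n} {P Q : VPred n} → P ⊆ᵇ Q → cnt P ≤ cnt Q
cnt-mono h = sum-mono (λ x → 𝟙-mono (h x))

cnt≤n : ∀ {n} (P : VPred n) → cnt P ≤ n
cnt≤n {n} P = ≤-trans (sum-bound (λ x → 𝟙-mono {P x} {true} _)) (≤-reflexive (*-identityʳ n))

cnt-all : ∀ n → cnt {n} (λ _ → true) ≡ n
cnt-all n = trans (sum-const n 1) (*-identityʳ n)

cnt-cover : ∀ {n} {P Q R : VPred n} → (∀ x → x ∈ᵇ P → x ∈ᵇ Q ⊎ x ∈ᵇ R) → cnt P ≤ cnt Q + cnt R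
cnt-cover {P = P} {Q} {R} h = ≤-trans (sum-mono pointwise) (≤-reflexive (sum-+ _ _))
  where
  pointwise : ∀ x → 𝟙 (P x) ≤ 𝟙 (Q x) + 𝟙 (R x)
  pointwise x with P x | Q x | R x | h x
  ... | false | _ | _ | _ = z≤n
  ... | true | true | _ | _ = s≤s z≤n
  ... | true | false | true | _ = ≤-refl
  ... | true | false | false | h′ with h′ _
  ...   | inj₁ ()
  ...   | inj₂ ()

cnt-split : ∀ {n} (P Q : VPred n) → cnt (P ∩ Q) + cnt (P ∩ ∁ Q) ≡ cnt P
cnt-split P Q = trans (sym (sum-+ _ _)) (sum-cong pointwise)
  where
  pointwise : ∀ x → 𝟙 (P x ∧ Q x) + 𝟙 (P x ∧ not (Q x)) ≡ 𝟙 (P x)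
  pointwise x with P x | Q x
  ... | false | _ = refl
  ... | true | true = refl
  ... | true | false = refl

cnt-disjoint : ∀ {n} {P Q R : VPred n} → P ⊆ᵇ R → Q ⊆ᵇ R → Disj P Q → cnt P + cnt Q ≤ cnt R
cnt-disjoint {P = P} {Q} {R} p q d = begin
  cnt P + cnt Q                   ≤⟨ +-mono-≤ (cnt-mono (λ x i → ∧⁺ (p x i) i))
                                              (cnt-mono (λ x i → ∧⁺ (q x i) (not⁺ (λ j → d x j i)))) ⟩
  cnt (R ∩ P) + cnt (R ∩ ∁ P)     ≡⟨ cnt-split R P ⟩
  cnt R                           ∎
  where open ≤-Reasoning

∈⇒cnt-pos : ∀ {n} {P : VPred n} {x} → x ∈ᵇ P → 1 ≤ cnt P
∈⇒cnt-pos {P = P} {x} p = ≤-trans (𝟙-mono {true} {P x} (λ _ → p)) (term≤sum _ x)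

-- The value of `P zero` is a separate argument, so that facts about `enum` follow by cases on a
-- Boolean.
enum-step : ∀ {n c} (b : Bool) → (Fin c → Fin n) → Fin (𝟙 b + c) → Fin (suc n)
enum-step false e i       = suc (e i)
enum-step true  e zero    = zero
enum-step true  e (suc i) = suc (e i)

opaque
  unfolding sum

  enum : ∀ {n} (P : VPred n) → Fin (cnt P) → Fin n
  enum {suc n} P = enum-step (P zero) (enum (P ∘ suc))

  enum-∈ : ∀ {n} (P : VPred n) i → enum P i ∈ᵇ P
  enum-∈ {suc n} P = go (P zero) refl
    where
    go : ∀ b → P zero ≡ b → ∀ i → enum-step b (enum (P ∘ suc)) i ∈ᵇ P
    go false eq i       = enum-∈ (P ∘ suc) i
    go true  eq zero    = Equivalence.from T-≡ eq
    go true  eq (suc i) = enum-∈ (P ∘ suc) i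

  enum-injective : ∀ {n} (P : VPred n) → Injective _≡_ _≡_ (enum P)
  enum-injective {suc n} P = go (P zero)
    where
    go : ∀ b → Injective _≡_ _≡_ (enum-step b (enum (P ∘ suc)))
    go false eq = enum-injective (P ∘ suc) (suc-injective eq)
    go true {zero}  {zero}  eq = refl
    go true {suc i} {suc j} eq = cong suc (enum-injective (P ∘ suc) (suc-injective eq))

  enum-surjective : ∀ {n} (P : VPred n) y → y ∈ᵇ P → ∃ λ i → enum P i ≡ y
  enum-surjective {suc n} P = go (P zero) refl
    where
    go : ∀ b → P zero ≡ b → ∀ y → y ∈ᵇ P → ∃ λ i → enum-step b (enum (P ∘ suc)) i ≡ y
    go false eq zero    p = ⊥-elim (subst B.T eq p)
    go true  eq zero    p = zero , refl
    go false eq (suc y) p = map₂ (cong suc) (enum-surjective (P ∘ suc) y p)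
    go true  eq (suc y) p = let i , e = enum-surjective (P ∘ suc) y p in suc i , cong suc e

  sum-enum : ∀ {n} (P : VPred n) (g : Fin n → ℕ) → sum (g ∘ enum P) ≡ sum (λ y → 𝟙 (P y) * g y)
  sum-enum {zero}  P g = refl
  sum-enum {suc n} P g = trans (go (P zero)) (cong (𝟙 (P zero) * g zero +_) (sum-enum (P ∘ suc) (g ∘ suc)))
    where
    go : ∀ b → sum (g ∘ enum-step b (enum (P ∘ suc))) ≡ 𝟙 b * g zero + sum (g ∘ suc ∘ enum (P ∘ suc))
    go false = refl
    go true  = cong (_+ sum (g ∘ suc ∘ enum (P ∘ suc))) (sym (*-identityˡ (g zero)))

cnt-enum : ∀ {n} {P Q : VPred n} → Q ⊆ᵇ P → cnt (Q ∘ enum P) ≡ cnt Q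
cnt-enum {P = P} {Q} sub = trans (sum-enum P (𝟙 ∘ Q)) (sum-cong pointwise)
  where
  pointwise : ∀ y → 𝟙 (P y) * 𝟙 (Q y) ≡ 𝟙 (Q y)
  pointwise y with P y | Q y | sub y
  ... | true | q | _ = *-identityˡ (𝟙 q)
  ... | false | false | _ = refl
  ... | false | true | s = ⊥-elim (s _)

cnt-pos⇒∈ : ∀ {n} (P : VPred n) → 1 ≤ cnt P → ∃ (_∈ᵇ P)
cnt-pos⇒∈ P h = enum P (Fin.fromℕ< h) , enum-∈ P _

injection⇒≤cnt : ∀ {w n} {P : VPred n} (f : Fin w → Fin n) → Injective _≡_ _≡_ f →
                 (∀ i → f i ∈ᵇ P) → w ≤ cnt P
injection⇒≤cnt {P = P} f inj mem = injective⇒≤ {f = λ i → proj₁ (pre i)} λ {i} {j} eq →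
  inj (trans (sym (proj₂ (pre i))) (trans (cong (enum P) eq) (proj₂ (pre j))))
  where
  pre : ∀ i → ∃ λ k → enum P k ≡ f i
  pre i = enum-surjective P (f i) (mem i)

opaque
  unfolding sum

  prefix : ∀ {n} k (P : VPred n) → k ≤ cnt P → Σ (VPred n) λ Q → Q ⊆ᵇ P × cnt Q ≡ k
  prefix {zero}  zero P h = P , (λ _ → id) , refl
  prefix {suc n} k P h with P zero in eq
  ... | false = let Q , sub , c = prefix k (P ∘ suc) h in
      (λ { zero → false ; (suc y) → Q y }) , (λ { (suc y) → sub y }) , c
  prefix {suc n} zero P h | true = (λ _ → false) , (λ _ ()) , trans (sum-const (suc n) 0) (*-zeroʳ (suc n))
  prefix {suc n} (suc k) P h | true = let Q , sub , c = prefix k (P ∘ suc) (s≤s⁻¹ h) in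
      (λ { zero → true ; (suc y) → Q y }) ,
      (λ { zero _ → Equivalence.from T-≡ eq ; (suc y) → sub y }) , cong suc c

split : ∀ {n} h a (Z : VPred n) → h * a ≤ cnt Z →
        Σ (Fin h → VPred n) λ Zs → (∀ i → Zs i ⊆ᵇ Z) × (∀ i → cnt (Zs i) ≡ a) ×
          (∀ i j → i ≢ j → Disj (Zs i) (Zs j))
split zero    a Z le = (λ ()) , (λ ()) , (λ ()) , λ ()
split (suc h) a Z le =
  let Q , sub , c = prefix a Z (≤-trans (m≤m+n a _) le)
      le′ = +-cancelˡ-≤ a _ _ (begin
        a + h * a                      ≤⟨ le ⟩
        cnt Z                          ≡⟨ cnt-split Z Q ⟨
        cnt (Z ∩ Q) + cnt (Z ∩ ∁ Q)    ≤⟨ +-monoˡ-≤ _ (cnt-mono (λ _ → ∧⁻ʳ)) ⟩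
        cnt Q + cnt (Z ∩ ∁ Q)          ≡⟨ cong (_+ cnt (Z ∩ ∁ Q)) c ⟩
        a + cnt (Z ∩ ∁ Q)              ∎)
      Zs , subs , cs , ds = split h a (Z ∩ ∁ Q) le′
      out = λ j x (z : x ∈ᵇ Zs j) q → not⁻ (∧⁻ʳ {Z x} (subs j x z)) q
  in (λ { zero → Q ; (suc i) → Zs i })
   , (λ { zero → sub ; (suc i) x p → ∧⁻ˡ (subs i x p) })
   , (λ { zero → c ; (suc i) → cs i })
   , (λ { zero zero n → ⊥-elim (n refl)
        ; zero (suc j) _ x q z → out j x z q
        ; (suc i) zero _ x z q → out i x z q
        ; (suc i) (suc j) n → ds i j (n ∘ cong suc) })
  where open ≤-Reasoning

-- Markov's inequality, cross-multiplied: the mean of `g` over `P` is at most K/M, and at most half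
-- of `P` exceeds twice that. An exceptional element has `g x * M` at least `suc (2 * K)`; the extra
-- 1 keeps the count strict when K is 0.
markov : ∀ {n} (P : VPred n) (g : Fin n → ℕ) M K →
         sum (λ x → 𝟙 (P x) * g x) * M ≤ cnt P * K →
         cnt P ≤ 2 * cnt (P ∩ (λ x → g x * M ≤ᵇ 2 * K))
markov {n} P g M K h = +-cancelʳ-≤ (2 * b) _ _ (begin
    cnt P + 2 * b      ≤⟨ +-monoʳ-≤ (cnt P) half ⟩
    cnt P + cnt P      ≡⟨ cong (cnt P +_) (+-identityʳ (cnt P)) ⟨
    2 * cnt P          ≡⟨ cong (2 *_) (cnt-split P good) ⟨
    2 * (a + b)        ≡⟨ *-distribˡ-+ 2 a b ⟩
    2 * a + 2 * b      ∎)
  where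
  open ≤-Reasoning
  good = λ x → g x * M ≤ᵇ 2 * K
  a = cnt (P ∩ good)
  b = cnt (P ∩ ∁ good)
  pointwise : ∀ x → 𝟙 (P x ∧ not (good x)) * suc (2 * K) ≤ 𝟙 (P x) * g x * M
  pointwise x with P x | good x in eq
  ... | false | _ = z≤n
  ... | true | true = z≤n
  ... | true | false = begin
    1 * suc (2 * K)  ≡⟨ *-identityˡ _ ⟩
    suc (2 * K)      ≤⟨ ≰⇒> (λ le → subst B.T eq (≤⇒≤ᵇ le)) ⟩
    g x * M          ≡⟨ cong (_* M) (*-identityˡ (g x)) ⟨
    1 * g x * M      ∎
  total : b * suc (2 * K) ≤ cnt P * K
  total = begin
    b * suc (2 * K)                                       ≡⟨ *-distribʳ-sum (suc (2 * K)) _ ⟩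
    sum (λ x → 𝟙 (P x ∧ not (good x)) * suc (2 * K))      ≤⟨ sum-mono pointwise ⟩
    sum (λ x → 𝟙 (P x) * g x * M)                         ≡⟨ *-distribʳ-sum M _ ⟨
    sum (λ x → 𝟙 (P x) * g x) * M                         ≤⟨ h ⟩
    cnt P * K                                             ∎
  half : 2 * b ≤ cnt P
  half = ≮⇒≥ λ lt → n≮n (cnt P * K) (begin-strict
    cnt P * K            <⟨ m<n+m (cnt P * K) (n≢0⇒n>0 (λ b≡0 → case subst (λ t → cnt P < 2 * t) b≡0 lt of λ ())) ⟩
    b + cnt P * K        ≤⟨ +-monoʳ-≤ b (*-monoˡ-≤ K (<⇒≤ lt)) ⟩
    b + 2 * b * K        ≡⟨ arith b K ⟩
    b * suc (2 * K)      ≤⟨ total ⟩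
    cnt P * K            ∎)
    where
    arith : ∀ b K → b + 2 * b * K ≡ b * suc (2 * K)
    arith = solve-∀

-- Counting the pairs of a relation between two sets

deg : ∀ {n} → (Fin n → Fin n → Bool) → VPred n → Fin n → ℕ
deg R Y x = cnt (λ y → Y y ∧ R x y)

pairs : ∀ {n} → (Fin n → Fin n → Bool) → VPred n → VPred n → ℕ
pairs R X Y = sum (λ x → 𝟙 (X x) * deg R Y x)

pairs′ : ∀ {n} (R : Fin n → Fin n → Bool) X Y →
        pairs R X Y ≡ sum (λ x → sum (λ y → 𝟙 (X x) * (𝟙 (Y y) * 𝟙 (R x y))))
pairs′ R X Y = sum-cong λ x → trans (*-distribˡ-sum (𝟙 (X x)) _)
  (sum-cong λ y → cong (𝟙 (X x) *_) (𝟙-∧ (Y y) (R x y)))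

pairs-flip : ∀ {n} (R : Fin n → Fin n → Bool) X Y → pairs R X Y ≡ pairs (flip R) Y X
pairs-flip R X Y = begin
  pairs R X Y                                                ≡⟨ pairs′ R X Y ⟩
  sum (λ x → sum (λ y → 𝟙 (X x) * (𝟙 (Y y) * 𝟙 (R x y))))    ≡⟨ sum-comm (λ x y → 𝟙 (X x) * (𝟙 (Y y) * 𝟙 (R x y))) ⟩
  sum (λ y → sum (λ x → 𝟙 (X x) * (𝟙 (Y y) * 𝟙 (R x y))))    ≡⟨ sum-cong (λ y → sum-cong λ x → arith (𝟙 (X x)) (𝟙 (Y y)) (𝟙 (R x y))) ⟩
  sum (λ y → sum (λ x → 𝟙 (Y y) * (𝟙 (X x) * 𝟙 (R x y))))    ≡⟨ pairs′ (flip R) Y X ⟨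
  pairs (flip R) Y X                                         ∎
  where
  open ≡-Reasoning
  arith : ∀ a b c → a * (b * c) ≡ b * (a * c)
  arith = solve-∀

pairs-bound : ∀ {n} (R : Fin n → Fin n → Bool) X Y M K → (∀ x → x ∈ᵇ X → deg R Y x * M ≤ K) →
              pairs R X Y * M ≤ cnt X * K
pairs-bound R X Y M K h = begin
  pairs R X Y * M                        ≡⟨ *-distribʳ-sum M _ ⟩
  sum (λ x → 𝟙 (X x) * deg R Y x * M)    ≤⟨ sum-mono pointwise ⟩
  sum (λ x → 𝟙 (X x) * K)                ≡⟨ *-distribʳ-sum K _ ⟨
  cnt X * K                              ∎
  where
  open ≤-Reasoning
  pointwise : ∀ x → 𝟙 (X x) * deg R Y x * M ≤ 𝟙 (X x) * K
  pointwise x with X x | h x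
  ... | false | _ = z≤n
  ... | true  | h′ = begin
    1 * deg R Y x * M    ≡⟨ cong (_* M) (*-identityˡ (deg R Y x)) ⟩
    deg R Y x * M        ≤⟨ h′ _ ⟩
    K                    ≡⟨ *-identityˡ K ⟨
    1 * K                ∎

pairs-complement : ∀ {n} (R : Fin n → Fin n → Bool) X Y →
                   pairs R X Y + pairs (λ x y → not (R x y)) X Y ≡ cnt X * cnt Y
pairs-complement R X Y = begin
  pairs R X Y + pairs (λ x y → not (R x y)) X Y   ≡⟨ sum-+ (λ x → 𝟙 (X x) * deg R Y x) _ ⟨
  sum (λ x → 𝟙 (X x) * deg R Y x + 𝟙 (X x) * deg (λ x y → not (R x y)) Y x)
                                                  ≡⟨ sum-cong (λ x → sym (*-distribˡ-+ (𝟙 (X x)) (deg R Y x) _)) ⟩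
  sum (λ x → 𝟙 (X x) * (deg R Y x + deg (λ x y → not (R x y)) Y x))
                                                  ≡⟨ sum-cong (λ x → cong (𝟙 (X x) *_) (cnt-split Y (R x))) ⟩
  sum (λ x → 𝟙 (X x) * cnt Y)                     ≡⟨ *-distribʳ-sum (cnt Y) _ ⟨
  cnt X * cnt Y                                   ∎
  where open ≡-Reasoning

pairs-full⇒all : ∀ {n} (R : Fin n → Fin n → Bool) X Y → pairs R X Y ≡ cnt X * cnt Y →
                 ∀ x y → x ∈ᵇ X → y ∈ᵇ Y → B.T (R x y)
pairs-full⇒all R X Y eq x y p q with R x y in r
... | true  = _
... | false = ⊥-elim (n≮n 0 (begin
  1                                     ≤⟨ ∈⇒cnt-pos {P = λ z → Y z ∧ not (R x z)} {y} (∧⁺ q (subst (B.T ∘ not) (sym r) _)) ⟩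
  deg R̄ Y x                             ≡⟨ *-identityˡ (deg R̄ Y x) ⟨
  1 * deg R̄ Y x                         ≡⟨ cong (λ b → 𝟙 b * deg R̄ Y x) (Equivalence.to T-≡ p) ⟨
  𝟙 (X x) * deg R̄ Y x                   ≡⟨ sum≡0⇒term≡0 _ none x ⟩
  0                                     ∎))
  where
  open ≤-Reasoning
  R̄ = λ x y → not (R x y)
  none : pairs R̄ X Y ≡ 0
  none = +-cancelˡ-≡ (pairs R X Y) _ _
    (trans (pairs-complement R X Y) (trans (sym eq) (sym (+-identityʳ _))))

pairs-enum : ∀ {n} (W : VPred n) (R : Fin n → Fin n → Bool) {X Y} → X ⊆ᵇ W → Y ⊆ᵇ W →
             pairs (λ i j → R (enum W i) (enum W j)) (X ∘ enum W) (Y ∘ enum W) ≡ pairs R X Y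
pairs-enum W R {X} {Y} p q = begin
  sum (λ i → 𝟙 (X (enum W i)) * cnt ((λ y → Y y ∧ R (enum W i) y) ∘ enum W))
      ≡⟨ sum-cong (λ i → cong (𝟙 (X (enum W i)) *_) (cnt-enum {P = W} (λ y → q y ∘ ∧⁻ˡ))) ⟩
  sum ((λ x → 𝟙 (X x) * deg R Y x) ∘ enum W)          ≡⟨ sum-enum W _ ⟩
  sum (λ x → 𝟙 (W x) * (𝟙 (X x) * deg R Y x))         ≡⟨ sum-cong pointwise ⟩
  sum (λ x → 𝟙 (X x) * deg R Y x)                     ∎
  where
  open ≡-Reasoning
  pointwise : ∀ x → 𝟙 (W x) * (𝟙 (X x) * deg R Y x) ≡ 𝟙 (X x) * deg R Y x
  pointwise x with W x | X x | p x
  ... | true | _ | _ = *-identityˡ _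
  ... | false | false | _ = refl
  ... | false | true | f = ⊥-elim (f _)

-- Tournaments and chains

edge⇒≢ : ∀ T {x y} → Edge T x y → x ≢ y
edge⇒≢ T {x} e refl = subst B.T (irrefl T x) e

edge-asym : ∀ T {x y} → Edge T x y → ¬ Edge T y x
edge-asym T {x} {y} e e′ =
  not⁻ {adj T x y} (subst B.T (tourn T x y (edge⇒≢ T e)) e′) e

edge-total : ∀ T {x y} → x ≢ y → Edge T x y ⊎ Edge T y x
edge-total T {x} {y} x≢y with T? (adj T x y)
... | yes e = inj₁ e
... | no ¬e = inj₂ (subst B.T (sym (tourn T x y x≢y)) (not⁺ ¬e))

all-vertices : ∀ {n} → VPred n
all-vertices _ = true

sub : (T : Tour) → VPred (size T) → Tour
sub T P = record
  { size   = cnt P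
  ; adj    = λ i j → adj T (enum P i) (enum P j)
  ; irrefl = λ i → irrefl T (enum P i)
  ; tourn  = λ i j i≢j → tourn T _ _ (i≢j ∘ enum-injective P)
  }

contains-sub : ∀ T P H → Contains (sub T P) H → Contains T H
contains-sub T P H (φ , inj , hom) = enum P ∘ φ , inj ∘ enum-injective P , hom

-- A positive form of transitivity: an explicit ordering can be searched for, lifted out of an
-- induced subtournament and concatenated, unlike the mere absence of cycles.
record Chain (T : Tour) (P : VPred (size T)) (r : ℕ) : Set where
  constructor chain
  field
    vertices : List (V T)
    length≡  : length vertices ≡ r
    within   : All (_∈ᵇ P) vertices
    ordered  : AllPairs (Edge T) vertices

chain-⊆ : ∀ {T P Q r} → P ⊆ᵇ Q → Chain T P r → Chain T Q r
chain-⊆ sub (chain xs l m e) = chain xs l (All.map (sub _) m) e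

chain-lift : ∀ {T P Q R r} → (∀ i → i ∈ᵇ Q → enum P i ∈ᵇ R) → Chain (sub T P) Q r → Chain T R r
chain-lift {P = P} h (chain xs l m e) =
  chain (map (enum P) xs) (trans (length-map (enum P) xs) l) (All.map⁺ (All.map (h _) m)) (AllPairs.map⁺ e)

chain-++ : ∀ {T P Q a b} → (∀ x y → x ∈ᵇ P → y ∈ᵇ Q → Edge T x y) →
           Chain T P a → Chain T Q b → Chain T all-vertices (a + b)
chain-++ h (chain xs l m e) (chain ys l′ m′ e′) =
  chain (xs ++ ys) (trans (length-++ xs) (cong₂ _+_ l l′)) (All.universal (λ _ → _) _)
    (AllPairs.++⁺ e e′ (All.map (λ p → All.map (h _ _ p) m′) m))

lookup-edge : ∀ {T} {xs : List (V T)} → AllPairs (Edge T) xs → ∀ {i j} → toℕ i < toℕ j →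
              Edge T (lookup xs i) (lookup xs j)
lookup-edge (a ∷ e) {zero}  {suc j} _   = All.lookup a (∈-lookup j)
lookup-edge {T} (a ∷ e) {suc i} {suc j} i<j = lookup-edge {T} e (s<s⁻¹ i<j)

lookup-edge⁻ : ∀ {T} {xs : List (V T)} → AllPairs (Edge T) xs → ∀ {i j} →
               Edge T (lookup xs i) (lookup xs j) → toℕ i < toℕ j
lookup-edge⁻ {T} {xs} e {i} {j} ij with <-cmp (toℕ i) (toℕ j)
... | tri< lt _ _ = lt
... | tri≈ _ eq _ = ⊥-elim (edge⇒≢ T ij (cong (lookup xs) (toℕ-injective eq)))
... | tri> _ _ gt = ⊥-elim (edge-asym T ij (lookup-edge {T} e gt))

lookup-injective : ∀ {T} {xs : List (V T)} → AllPairs (Edge T) xs → Injective _≡_ _≡_ (lookup xs)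
lookup-injective {T} e {i} {j} eq with <-cmp (toℕ i) (toℕ j)
... | tri< lt _ _ = ⊥-elim (edge⇒≢ T (lookup-edge {T} e lt) eq)
... | tri≈ _ i≡j _ = toℕ-injective i≡j
... | tri> _ _ gt = ⊥-elim (edge⇒≢ T (lookup-edge {T} e gt) (sym eq))

chain≤cnt : ∀ {T P r} → Chain T P r → r ≤ cnt P
chain≤cnt {T} (chain xs refl m e) = injection⇒≤cnt (lookup xs) (lookup-injective {T} e) (λ i → All.lookup m (∈-lookup i))

chain-cons : ∀ {T P r v} → v ∈ᵇ P → Chain T (P ∩ adj T v) r → Chain T P (suc r)
chain-cons {P = P} {v = v} v∈P (chain xs l m e) =
  chain (v ∷ xs) (cong suc l) (v∈P ∷ All.map ∧⁻ˡ m) (All.map (λ {x} → ∧⁻ʳ {P x}) m ∷ e)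

chain-snoc : ∀ {T P r v} → v ∈ᵇ P → Chain T (P ∩ (λ x → adj T x v)) r → Chain T P (suc r)
chain-snoc {P = P} {v = v} v∈P (chain xs l m e) =
  chain (xs ++ v ∷ []) (trans (length-++ xs) (trans (+-comm _ 1) (cong suc l)))
    (All.++⁺ (All.map ∧⁻ˡ m) (v∈P ∷ []))
    (AllPairs.++⁺ e ([] ∷ []) (All.map (λ {x} p → ∧⁻ʳ {P x} p ∷ []) m))

-- A chain is a first vertex followed by a chain among its out-neighbours, so the search recurses
-- into `P ∩ adj T v`.
chain? : ∀ T P r → Dec (Chain T P r)
chain? T P zero    = yes (chain [] refl [] [])
chain? T P (suc r) = map′ to from (any? λ v → T? (P v) ×-dec chain? T (P ∩ adj T v) r)
  where
  to : (∃ λ v → v ∈ᵇ P × Chain T (P ∩ adj T v) r) → Chain T P (suc r)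
  to (v , v∈P , c) = chain-cons v∈P c
  from : Chain T P (suc r) → ∃ λ v → v ∈ᵇ P × Chain T (P ∩ adj T v) r
  from (chain (v ∷ xs) l (v∈P ∷ m) (a ∷ e)) =
    v , v∈P , chain xs (cong pred l) (All.zipWith (λ (p , q) → ∧⁺ p q) (m , a)) e

-- Chains are the vertex sequences of transitive subtournaments, so the length of a
-- longest one is tr(T).
MaxChain : Tour → ℕ → Set
MaxChain T t = Chain T all-vertices t × (∀ {r} → Chain T all-vertices r → r ≤ t)

opaque
  max-chain : ∀ T → ∃ (MaxChain T)
  max-chain T = search (size T) λ c → ≤-trans (chain≤cnt {T} c) (cnt≤n all-vertices)
    where
    search : ∀ k → (∀ {r} → Chain T all-vertices r → r ≤ k) → ∃ (MaxChain T)
    search k bound with chain? T all-vertices k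
    search k bound | yes c = k , c , bound
    search zero bound | no ¬c = ⊥-elim (¬c (chain [] refl [] []))
    search (suc k) bound | no ¬c = search k λ {r} c →
      s≤s⁻¹ (≤∧≢⇒< (bound c) λ r≡ → ¬c (subst (Chain T all-vertices) r≡ c))

-- Transitive sets versus chains, and a Ramsey bound

ofList : ∀ {n} → List (Fin n) → VPred n
ofList xs y = isYes (any? λ i → lookup xs i Fin.≟ y)

ofList⁺ : ∀ {n} (xs : List (Fin n)) i → lookup xs i ∈ᵇ ofList xs
ofList⁺ xs i = fromWitness (i , refl)

ofList⁻ : ∀ {n} (xs : List (Fin n)) {y} → y ∈ᵇ ofList xs → ∃ λ i → lookup xs i ≡ y
ofList⁻ xs = toWitness

-- Along the walk the position in `xs` never decreases, whereas the closing edge would have to lead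
-- to a strictly later position than that of `x k`.
chain-acyclic : ∀ {T xs} → AllPairs (Edge T) xs → ∀ k (x : ℕ → V T) → (∀ i → i ≤ k → x i ∈ᵇ ofList xs) →
                (∀ i → i < k → Edge T (x i) (x (suc i))) → ¬ Edge T (x k) (x 0)
chain-acyclic {T} {xs} e k x mem step back =
  let p₀ , eq₀ = ofList⁻ xs (mem 0 z≤n)
      pₖ , eqₖ = ofList⁻ xs (mem k ≤-refl)
  in <⇒≱ (lookup-edge⁻ {T} e (subst₂ (Edge T) (sym eqₖ) (sym eq₀) back)) (increasing p₀ eq₀ k ≤-refl pₖ eqₖ)
  where
  increasing : ∀ p₀ → lookup xs p₀ ≡ x 0 → ∀ i → i ≤ k → ∀ p → lookup xs p ≡ x i → toℕ p₀ ≤ toℕ p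
  increasing p₀ eq₀ zero    i≤k p eq = ≤-reflexive (cong toℕ (lookup-injective {T} e (trans eq₀ (sym eq))))
  increasing p₀ eq₀ (suc i) i<k p eq =
    let q , eq′ = ofList⁻ xs (mem i (<⇒≤ i<k)) in
    ≤-trans (increasing p₀ eq₀ i (<⇒≤ i<k) q eq′)
            (<⇒≤ (lookup-edge⁻ {T} e (subst₂ (Edge T) (sym eq′) (sym eq) (step i i<k))))

subsetOf : ∀ {n} → VPred n → Vec.Vec Bool n
subsetOf = Vec.tabulate

∈-subsetOf⁺ : ∀ {n} {P : VPred n} {x} → x ∈ᵇ P → x ∈ subsetOf P
∈-subsetOf⁺ {P = P} {x} p = lookup⇒[]= x _ (trans (lookup∘tabulate P x) (Equivalence.to T-≡ p))

∈-subsetOf⁻ : ∀ {n} {P : VPred n} {x} → x ∈ subsetOf P → x ∈ᵇ P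
∈-subsetOf⁻ {P = P} {x} p = Equivalence.from T-≡ (trans (sym (lookup∘tabulate P x)) ([]=⇒lookup p))

∈ᵇ-lookup⁻ : ∀ {n} {S : Vec.Vec Bool n} {x} → x ∈ᵇ Vec.lookup S → x ∈ S
∈ᵇ-lookup⁻ {S = S} {x} p = lookup⇒[]= x S (Equivalence.to T-≡ p)

∣∣≡cnt : ∀ {n} (S : Vec.Vec Bool n) → ∣ S ∣ ≡ cnt (Vec.lookup S)
∣∣≡cnt Vec.[] = sym (sum-empty _)
∣∣≡cnt (true Vec.∷ S)  = trans (cong suc (∣∣≡cnt S)) (sym (sum-suc _))
∣∣≡cnt (false Vec.∷ S) = trans (∣∣≡cnt S) (sym (sum-suc _))

∣subsetOf∣ : ∀ {n} (P : VPred n) → ∣ subsetOf P ∣ ≡ cnt P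
∣subsetOf∣ P = trans (∣∣≡cnt (subsetOf P)) (sum-cong λ x → cong 𝟙 (lookup∘tabulate P x))

-- In a tournament, excluding directed triangles already excludes all cycles, so only cycles of
-- length three have to be extracted from `Transitive`.
NoTriangle : (T : Tour) → VPred (size T) → Set
NoTriangle T P = ∀ a b c → a ∈ᵇ P → b ∈ᵇ P → c ∈ᵇ P → Edge T a b → Edge T b c → ¬ Edge T c a

-- The step of insertion sort with adjacency as the comparison. If x → y for the head y, then x → z
-- for every later z, since z → x would close a triangle x, y, z; if y → x, the insertion moves past
-- y.
insert : ∀ T {P} → NoTriangle T P → ∀ x xs → x ∈ᵇ P → All (_∈ᵇ P) xs → All (x ≢_) xs →
         AllPairs (Edge T) xs → Σ (List (V T)) λ zs → zs ↭ x ∷ xs × AllPairs (Edge T) zs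
insert T nt x [] x∈P [] [] [] = x ∷ [] , ↭-refl , [] ∷ []
insert T {P} nt x (y ∷ ys) x∈P (y∈P ∷ m) (x≢y ∷ x≢ys) (a ∷ e) with edge-total T x≢y
... | inj₁ xy = x ∷ y ∷ ys , ↭-refl , (xy ∷ All.zipWith outward (All.zip (m , x≢ys) , a)) ∷ a ∷ e
  where
  outward : ∀ {z} → (z ∈ᵇ P × x ≢ z) × Edge T y z → Edge T x z
  outward ((z∈P , x≢z) , yz) with edge-total T x≢z
  ... | inj₁ xz = xz
  ... | inj₂ zx = ⊥-elim (nt x y _ x∈P y∈P z∈P xy yz zx)
... | inj₂ yx =
  let zs , perm , e′ = insert T nt x ys x∈P m x≢ys e in
  y ∷ zs , ↭-trans (prep y perm) (swap y x ↭-refl) , All-resp-↭ (↭-sym perm) (yx ∷ a) ∷ e′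

topological-sort : ∀ T {P} → NoTriangle T P → ∀ xs → All (_∈ᵇ P) xs → AllPairs _≢_ xs →
                   Σ (List (V T)) λ zs → zs ↭ xs × AllPairs (Edge T) zs
topological-sort T nt [] [] [] = [] , ↭-refl , []
topological-sort T nt (x ∷ xs) (x∈P ∷ m) (x≢ ∷ u) =
  let ys , perm , e = topological-sort T nt xs m u
      zs , perm′ , e′ = insert T nt x ys x∈P (All-resp-↭ (↭-sym perm) m) (All-resp-↭ (↭-sym perm) x≢) e
  in zs , ↭-trans perm′ (prep x perm) , e′

no-triangle⇒chain : ∀ T {P} → NoTriangle T P → Chain T P (cnt P)
no-triangle⇒chain T {P} nt =
  let zs , perm , e = topological-sort T nt (List.tabulate (enum P)) m u in
  chain zs (trans (↭-length perm) (length-tabulate (enum P))) (All-resp-↭ (↭-sym perm) m) e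
  where
  m = All.tabulate⁺ (enum-∈ P)
  u = AllPairs.tabulate⁺ (λ i≢j → i≢j ∘ enum-injective P)

transitive⇒no-triangle : ∀ T {S} → Transitive T S → NoTriangle T (Vec.lookup S)
transitive⇒no-triangle T {S} tr a b c a∈ b∈ c∈ ab bc ca = tr (2 , x , mem , inj , step , ca)
  where
  x : ℕ → V T
  x 0 = a
  x 1 = b
  x _ = c
  mem : ∀ i → i ≤ 2 → x i ∈ S
  mem 0 _ = ∈ᵇ-lookup⁻ a∈
  mem 1 _ = ∈ᵇ-lookup⁻ b∈
  mem (suc (suc _)) _ = ∈ᵇ-lookup⁻ c∈
  inj : ∀ i j → i ≤ 2 → j ≤ 2 → x i ≡ x j → i ≡ j
  inj 0 0 _ _ _ = refl
  inj 1 1 _ _ _ = refl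
  inj 2 2 _ _ _ = refl
  inj 0 1 _ _ eq = ⊥-elim (edge⇒≢ T ab eq)
  inj 1 0 _ _ eq = ⊥-elim (edge⇒≢ T ab (sym eq))
  inj 1 2 _ _ eq = ⊥-elim (edge⇒≢ T bc eq)
  inj 2 1 _ _ eq = ⊥-elim (edge⇒≢ T bc (sym eq))
  inj 0 2 _ _ eq = ⊥-elim (edge⇒≢ T ca (sym eq))
  inj 2 0 _ _ eq = ⊥-elim (edge⇒≢ T ca eq)
  inj (suc (suc (suc _))) _ (s≤s (s≤s ())) _ _
  inj _ (suc (suc (suc _))) _ (s≤s (s≤s ())) _
  step : ∀ i → i < 2 → Edge T (x i) (x (suc i))
  step 0 _ = ab
  step 1 _ = bc
  step (suc (suc _)) (s≤s (s≤s ()))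

transitive⇒chain : ∀ T {S} → Transitive T S → Chain T (Vec.lookup S) ∣ S ∣
transitive⇒chain T {S} tr =
  subst (Chain T (Vec.lookup S)) (sym (∣∣≡cnt S)) (no-triangle⇒chain T (transitive⇒no-triangle T {S} tr))

chain⇒transitive : ∀ {T P r} → Chain T P r → Σ (VSet T) λ S → Transitive T S × r ≤ ∣ S ∣
chain⇒transitive {T} (chain xs refl m e) =
  subsetOf (ofList xs) ,
  (λ (k , x , mem , _ , step , back) → chain-acyclic {T} e k x (λ i i≤k → ∈-subsetOf⁻ (mem i i≤k)) step back) ,
  ≤-trans (injection⇒≤cnt (lookup xs) (lookup-injective {T} e) (ofList⁺ xs)) (≤-reflexive (sym (∣subsetOf∣ _)))

max-chain⇒IsTr : ∀ {T t} → MaxChain T t → IsTr T t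
max-chain⇒IsTr {T} (c , bound) =
  let S , tr , t≤S = chain⇒transitive c in
  (S , tr , ≤-antisym (upper S tr) t≤S) , upper
  where upper = λ S tr → bound (chain-⊆ (λ _ _ → _) (transitive⇒chain T {S} tr))

cnt-unique : ∀ {n} (P : VPred n) → (∀ x y → x ∈ᵇ P → y ∈ᵇ P → x ≡ y) → cnt P ≤ 1
cnt-unique P h = injective⇒≤ {f = λ _ → zero {0}} λ {i} {j} _ →
  enum-injective P (h _ _ (enum-∈ P i) (enum-∈ P j))

-- A vertex, its out-neighbours and its in-neighbours cover `P`, so one of the two neighbourhoods
-- has at least 2^k vertices; the vertex goes before or after the chain found there. Such
-- logarithmic chains settle small tournaments and ensure that tr(T) is large enough to be cut into
-- blocks.
ramsey : ∀ {T} k P → 2 ^ k ≤ cnt P → Chain T P (suc k)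
ramsey {T} zero P h = let v , v∈P = cnt-pos⇒∈ P h in chain-cons v∈P (chain [] refl [] [])
ramsey {T} (suc k) P h = go (2 ^ k ≤? cnt out) (2 ^ k ≤? cnt inn)
  where
  open ≤-Reasoning
  v∈P = cnt-pos⇒∈ P (≤-trans (m^n>0 2 (suc k)) h)
  v = proj₁ v∈P
  out inn single rest : VPred (size T)
  out = P ∩ adj T v
  inn = P ∩ (λ x → adj T x v)
  single x = isYes (x Fin.≟ v)
  rest x = out x ∨ inn x
  cover : ∀ x → x ∈ᵇ P → x ∈ᵇ single ⊎ x ∈ᵇ rest
  cover x x∈P with x Fin.≟ v
  ... | yes _ = inj₁ _
  ... | no x≢v with edge-total T x≢v
  ...   | inj₁ xv = inj₂ (Equivalence.from T-∨ (inj₂ (∧⁺ x∈P xv)))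
  ...   | inj₂ vx = inj₂ (Equivalence.from T-∨ (inj₁ (∧⁺ x∈P vx)))
  go : Dec (2 ^ k ≤ cnt out) → Dec (2 ^ k ≤ cnt inn) → Chain T P (2 + k)
  go (yes big) _ = chain-cons (proj₂ v∈P) (ramsey k _ big)
  go (no _) (yes big) = chain-snoc (proj₂ v∈P) (ramsey k _ big)
  go (no small) (no small′) = ⊥-elim (n≮n (2 ^ suc k) (begin-strict
    2 ^ suc k                  ≤⟨ h ⟩
    cnt P                      ≤⟨ cnt-cover cover ⟩
    cnt single + cnt rest      ≤⟨ +-mono-≤ (cnt-unique single λ x y p q → trans (toWitness p) (sym (toWitness q)))
                                           (cnt-cover λ x → Equivalence.to T-∨) ⟩
    1 + (cnt out + cnt inn)    ≤⟨ +-monoˡ-< (cnt inn) (≰⇒> small) ⟩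
    2 ^ k + cnt inn            <⟨ +-monoʳ-< (2 ^ k) (≰⇒> small′) ⟩
    2 ^ k + 2 ^ k              ≡⟨ cong (2 ^ k +_) (+-identityʳ (2 ^ k)) ⟨
    2 ^ suc k                  ∎))

-- Dense pairs and dense sequences

cnt-union : ∀ {h n} {P : VPred n} (Q : Fin h → VPred n) → (∀ x → x ∈ᵇ P → ∃ λ j → x ∈ᵇ Q j) →
            cnt P ≤ sum (λ j → cnt (Q j))
cnt-union {P = P} Q h = begin
  cnt P                                  ≤⟨ sum-mono pointwise ⟩
  sum (λ x → sum (λ j → 𝟙 (Q j x)))      ≡⟨ sum-comm (λ x j → 𝟙 (Q j x)) ⟩
  sum (λ j → cnt (Q j))                  ∎
  where
  open ≤-Reasoning
  pointwise : ∀ x → 𝟙 (P x) ≤ sum (λ j → 𝟙 (Q j x))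
  pointwise x with T? (P x)
  ... | no ¬p = ≤-trans (𝟙-mono {P x} {false} ¬p) z≤n
  ... | yes p = let j , q = h x p in
    ≤-trans (𝟙-mono {P x} {Q j x} (λ _ → q)) (term≤sum (λ j → 𝟙 (Q j x)) j)

nonEdge : (T : Tour) → V T → V T → Bool
nonEdge T x y = not (adj T x y)

-- Density at least 1 - 1/M from `X` to `Y`, expressed by missing edges because these are what
-- Markov's inequality bounds. Sizes are at least a/K, written without division.
record DensePair (T : Tour) (Z : VPred (size T)) (M K a : ℕ) : Set where
  field
    X Y      : VPred (size T)
    X⊆Z      : X ⊆ᵇ Z
    Y⊆Z      : Y ⊆ᵇ Z
    disjoint : Disj X Y
    X-large  : a ≤ K * cnt X
    Y-large  : a ≤ K * cnt Y
    dense    : pairs (nonEdge T) X Y * M ≤ cnt X * cnt Y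

-- Prescribing the pairs i < j is enough: the reversed pairs follow from the tournament law, and
-- injectivity from the disjointness of the sets to which this is applied.
Transversal : (T : Tour) (h : ℕ) → (Fin h → Fin h → Bool) → (Fin h → VPred (size T)) → Set
Transversal T h β Zs = Σ (Fin h → V T) λ φ → (∀ j → φ j ∈ᵇ Zs j) ×
  (∀ i j → toℕ i < toℕ j → adj T (φ i) (φ j) ≡ β i j)

-- 1/κ is the fraction of the vertices that survives the h rounds of the greedy embedding.
κ : ℕ → ℕ → ℕ
κ M zero    = 1
κ M (suc h) = suc h * (M * κ M h)

κ-pos : ∀ M → 1 ≤ M → ∀ h → 1 ≤ κ M h
κ-pos M M≥1 zero    = ≤-refl
κ-pos M M≥1 (suc h) = *-mono-≤ {1} {suc h} (s≤s z≤n) (*-mono-≤ M≥1 (κ-pos M M≥1 h))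

-- Greedy embedding: either some vertex of the first set keeps a 1/M fraction of each later set
-- on the prescribed side, or the vertices failing for one later set form a dense pair with it.
embed : ∀ T (Z : VPred (size T)) M → 1 ≤ M → ∀ a → 1 ≤ a → ∀ h β (Zs : Fin h → VPred (size T)) D →
        (∀ j → Zs j ⊆ᵇ Z) → (∀ j → a ≤ D * cnt (Zs j)) → (∀ i j → i ≢ j → Disj (Zs i) (Zs j)) →
        Transversal T h β Zs ⊎ DensePair T Z M (D * κ M h) a
embed T Z M M≥1 a a≥1 zero    β Zs D sub large disj = inj₁ ((λ ()) , (λ ()) , λ ())
embed T Z M M≥1 a a≥1 (suc h) β Zs D sub large disj =
  go (any? λ v → T? (Zs zero v) ×-dec all? λ j → ¬? (T? (bad j v)))
  where
  open ≤-Reasoning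
  nbr : Fin h → V T → VPred (size T)
  nbr j v y = isYes (adj T v y B.≟ β zero (suc j))
  bad : Fin h → VPred (size T)
  bad j v = Zs zero v ∧ (M * cnt (Zs (suc j) ∩ nbr j v) <ᵇ cnt (Zs (suc j)))

  κ≤ : ∀ D → D * M * κ M h ≤ D * κ M (suc h)
  κ≤ D = begin
    D * M * κ M h           ≡⟨ *-assoc D M (κ M h) ⟩
    D * (M * κ M h)         ≤⟨ *-monoʳ-≤ D (m≤n*m (M * κ M h) (suc h)) ⟩
    D * κ M (suc h)         ∎

  suc-h≤κ : suc h ≤ κ M (suc h)
  suc-h≤κ = begin
    suc h               ≡⟨ *-identityʳ (suc h) ⟨
    suc h * 1           ≤⟨ *-monoʳ-≤ (suc h) (*-mono-≤ M≥1 (κ-pos M M≥1 h)) ⟩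
    κ M (suc h)         ∎

  widen : DensePair T Z M (D * M * κ M h) a → DensePair T Z M (D * κ M (suc h)) a
  widen p = record { DensePair p
    ; X-large = ≤-trans (DensePair.X-large p) (*-monoˡ-≤ _ (κ≤ D))
    ; Y-large = ≤-trans (DensePair.Y-large p) (*-monoˡ-≤ _ (κ≤ D)) }

  extend : ∀ v → v ∈ᵇ Zs zero → Transversal T h (λ i j → β (suc i) (suc j)) (λ j → Zs (suc j) ∩ nbr j v) →
           Transversal T (suc h) β Zs
  extend v v∈ (φ , mem , hom) =
    (λ { zero → v ; (suc j) → φ j }) ,
    (λ { zero → v∈ ; (suc j) → ∧⁻ˡ (mem j) }) ,
    (λ { zero (suc j) _ → toWitness {a? = adj T v (φ j) B.≟ β zero (suc j)} (∧⁻ʳ {Zs (suc j) (φ j)} (mem j))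
       ; (suc i) (suc j) i<j → hom i j (s<s⁻¹ i<j) })

  bad-deg : ∀ j x → x ∈ᵇ bad j → (R : VPred (size T)) →
            (∀ y → y ∈ᵇ Zs (suc j) → y ∈ᵇ R → adj T x y ≡ β zero (suc j)) →
            cnt (Zs (suc j) ∩ R) * M ≤ cnt (Zs (suc j))
  bad-deg j x x∈ R h = begin
    cnt (Zs (suc j) ∩ R) * M            ≡⟨ *-comm _ M ⟩
    M * cnt (Zs (suc j) ∩ R)            ≤⟨ *-monoʳ-≤ M (cnt-mono λ y p →
                                             ∧⁺ {Zs (suc j) y} (∧⁻ˡ p) (fromWitness {a? = adj T x y B.≟ β zero (suc j)}
                                               (h y (∧⁻ˡ p) (∧⁻ʳ {Zs (suc j) y} p)))) ⟩
    M * cnt (Zs (suc j) ∩ nbr j x)      ≤⟨ <⇒≤ (<ᵇ⇒< _ _ (∧⁻ʳ {Zs zero x} x∈)) ⟩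
    cnt (Zs (suc j))                    ∎

  Zs-large : ∀ j → a ≤ D * κ M (suc h) * cnt (Zs j)
  Zs-large j = ≤-trans (large j) (*-monoˡ-≤ (cnt (Zs j)) (m≤m*n D (κ M (suc h)) {{>-nonZero (κ-pos M M≥1 (suc h))}}))

  bad-large : ∀ j → cnt (Zs zero) ≤ suc h * cnt (bad j) → a ≤ D * κ M (suc h) * cnt (bad j)
  bad-large j many = begin
    a                                   ≤⟨ large zero ⟩
    D * cnt (Zs zero)                   ≤⟨ *-monoʳ-≤ D (≤-trans many (*-monoˡ-≤ (cnt (bad j)) suc-h≤κ)) ⟩
    D * (κ M (suc h) * cnt (bad j))     ≡⟨ *-assoc D (κ M (suc h)) _ ⟨
    D * κ M (suc h) * cnt (bad j)       ∎

  pairWith : ∀ j → cnt (Zs zero) ≤ suc h * cnt (bad j) → DensePair T Z M (D * κ M (suc h)) a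
  pairWith j many = orient (β zero (suc j)) refl
    where
    X⊆Zs : bad j ⊆ᵇ Zs zero
    X⊆Zs x = ∧⁻ˡ
    apart : ∀ x → x ∈ᵇ bad j → ¬ x ∈ᵇ Zs (suc j)
    apart x = disj zero (suc j) (λ ()) x ∘ ∧⁻ˡ
    orient : ∀ b → β zero (suc j) ≡ b → DensePair T Z M (D * κ M (suc h)) a
    -- Bad vertices have few non-edges to the later set if a non-edge is prescribed, so the pair is
    -- dense from `bad j` to it. If an edge is prescribed they have few edges, and the pair is dense
    -- in the opposite direction.
    orient false eq = record
      { X⊆Z = λ x → sub zero x ∘ X⊆Zs x ; Y⊆Z = sub (suc j)
      ; disjoint = apart
      ; X-large = bad-large j many ; Y-large = Zs-large (suc j)
      ; dense = pairs-bound (nonEdge T) (bad j) (Zs (suc j)) M _ λ x x∈ →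
          bad-deg j x x∈ (nonEdge T x) λ y _ ne → trans (Equivalence.to T-not-≡ ne) (sym eq) }
    orient true eq = record
      { X⊆Z = sub (suc j) ; Y⊆Z = λ x → sub zero x ∘ X⊆Zs x
      ; disjoint = λ x p q → apart x q p
      ; X-large = Zs-large (suc j) ; Y-large = bad-large j many
      ; dense = begin
          pairs (nonEdge T) (Zs (suc j)) (bad j) * M           ≡⟨ cong (_* M) (pairs-flip (nonEdge T) (Zs (suc j)) (bad j)) ⟩
          pairs (flip (nonEdge T)) (bad j) (Zs (suc j)) * M    ≤⟨ pairs-bound _ (bad j) (Zs (suc j)) M _ (λ x x∈ →
              bad-deg j x x∈ (flip (nonEdge T) x) λ y y∈ ne → trans (forward x∈ y∈ ne) (sym eq)) ⟩
          cnt (bad j) * cnt (Zs (suc j))                       ≡⟨ *-comm (cnt (bad j)) _ ⟩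
          cnt (Zs (suc j)) * cnt (bad j)                       ∎ }
      where
      forward : ∀ {x y} → x ∈ᵇ bad j → y ∈ᵇ Zs (suc j) → B.T (nonEdge T y x) → adj T x y ≡ true
      forward {x} {y} x∈ y∈ ne =
        trans (tourn T y x (λ { refl → apart x x∈ y∈ })) (cong not (Equivalence.to T-not-≡ ne))

  go : Dec (∃ λ v → v ∈ᵇ Zs zero × (∀ j → ¬ v ∈ᵇ bad j)) →
       Transversal T (suc h) β Zs ⊎ DensePair T Z M (D * κ M (suc h)) a
  -- Each later set shrinks to the vertices on the prescribed side of v, at worst by a factor M, so
  -- the loss D becomes `D * M`.
  go (yes (v , v∈ , ok)) with embed T Z M M≥1 a a≥1 h (λ i j → β (suc i) (suc j)) (λ j → Zs (suc j) ∩ nbr j v)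
      (D * M) (λ j x → sub (suc j) x ∘ ∧⁻ˡ) large′ (λ i j i≢j x p q → disj (suc i) (suc j) (i≢j ∘ suc-injective) x (∧⁻ˡ p) (∧⁻ˡ q))
    where
    large′ : ∀ j → a ≤ D * M * cnt (Zs (suc j) ∩ nbr j v)
    large′ j = begin
      a                                         ≤⟨ large (suc j) ⟩
      D * cnt (Zs (suc j))                      ≤⟨ *-monoʳ-≤ D (≮⇒≥ λ lt → ok j (∧⁺ v∈ (<⇒<ᵇ lt))) ⟩
      D * (M * cnt (Zs (suc j) ∩ nbr j v))      ≡⟨ *-assoc D M _ ⟨
      D * M * cnt (Zs (suc j) ∩ nbr j v)        ∎
  ... | inj₁ tr = inj₁ (extend v v∈ tr)
  ... | inj₂ p = inj₂ (widen p)
  go (no none) with any? (λ j → cnt (Zs zero) ≤? suc h * cnt (bad j))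
  ... | yes (j , many) = inj₂ (pairWith j many)
  -- Every vertex of the first set is bad for one of the h later sets, but h bad sets, each below a
  -- fraction 1/(h + 1), cannot cover it.
  ... | no few = ⊥-elim (n≮n (h * cnt (Zs zero)) (begin-strict
    h * cnt (Zs zero)                           <⟨ m<n+m (h * cnt (Zs zero)) Z₀-pos ⟩
    suc h * cnt (Zs zero)                       ≤⟨ *-monoʳ-≤ (suc h) (cnt-union bad covered) ⟩
    suc h * sum (λ j → cnt (bad j))             ≡⟨ *-distribˡ-sum (suc h) _ ⟩
    sum (λ j → suc h * cnt (bad j))             ≤⟨ sum-bound (λ j → <⇒≤ (≰⇒> λ le → few (j , le))) ⟩
    h * cnt (Zs zero)                           ∎))
    where
    Z₀-pos : 0 < cnt (Zs zero)
    Z₀-pos = n≢0⇒n>0 λ eq → n≮n 0 (begin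
      1                      ≤⟨ a≥1 ⟩
      a                      ≤⟨ large zero ⟩
      D * cnt (Zs zero)      ≡⟨ cong (D *_) eq ⟩
      D * 0                  ≡⟨ *-zeroʳ D ⟩
      0                      ∎)
    covered : ∀ v → v ∈ᵇ Zs zero → ∃ λ j → v ∈ᵇ bad j
    covered v v∈ with any? (λ j → T? (bad j v))
    ... | yes p = p
    ... | no ¬p = ⊥-elim (none (v , v∈ , λ j b → ¬p (j , b)))

dense-pair : ∀ {T H} → ¬ Contains T H → ∀ M → 1 ≤ M → ∀ a → 1 ≤ a → ∀ Z → size H * a ≤ cnt Z →
             DensePair T Z M (κ M (size H)) a
dense-pair {T} {H} free M M≥1 a a≥1 Z big with split (size H) a Z big
... | Zs , sub , cnts , disj with embed T Z M M≥1 a a≥1 (size H) (adj H) Zs 1 sub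
        (λ j → ≤-reflexive (sym (trans (*-identityˡ _) (cnts j)))) disj
... | inj₂ p = subst (λ K → DensePair T Z M K a) (*-identityˡ _) p
... | inj₁ (φ , mem , hom) = ⊥-elim (free (φ , inj , iso))
  where
  inj : Injective _≡_ _≡_ φ
  inj {i} {j} eq with i Fin.≟ j
  ... | yes i≡j = i≡j
  ... | no i≢j = ⊥-elim (disj i j i≢j (φ i) (mem i) (subst (_∈ᵇ Zs j) (sym eq) (mem j)))
  iso : ∀ i j → adj T (φ i) (φ j) ≡ adj H i j
  iso i j with <-cmp (toℕ i) (toℕ j)
  ... | tri< lt _ _ = hom i j lt
  ... | tri≈ _ eq _ rewrite toℕ-injective eq = trans (irrefl T (φ j)) (sym (irrefl H j))
  ... | tri> _ i≢j gt = begin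
    adj T (φ i) (φ j)          ≡⟨ tourn T (φ j) (φ i) (λ eq → i≢j (cong toℕ (sym (inj eq)))) ⟩
    not (adj T (φ j) (φ i))    ≡⟨ cong not (hom j i gt) ⟩
    not (adj H j i)            ≡⟨ tourn H j i (λ eq → i≢j (cong toℕ (sym eq))) ⟨
    adj H i j                  ∎
    where open ≡-Reasoning

-- `Y` may depend on `S`: it is trimmed against the `S` already fixed, whereas `X` is trimmed in
-- advance. All later sets live inside `Y`, and `u` is the room they need.
record Step (T : Tour) (Z : VPred (size T)) (L s u : ℕ) : Set where
  field
    X    : VPred (size T)
    X⊆Z  : X ⊆ᵇ Z
    ∣X∣  : cnt X ≡ s
    rest : ∀ S → S ⊆ᵇ X → Σ (VPred (size T)) λ Y → Y ⊆ᵇ Z × Disj X Y × u ≤ cnt Y ×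
           (∀ S′ → S′ ⊆ᵇ Y → pairs (nonEdge T) S S′ * L ≤ cnt S * cnt S′)

-- Passing to the typical vertices of a dense pair makes the density survive the choice of an
-- arbitrary, possibly tiny, S ⊆ X and afterwards of an arbitrary S′ ⊆ Y.
step : ∀ {T H} → ¬ Contains T H → ∀ L → 1 ≤ L → ∀ s u → 1 ≤ s → ∀ Z →
       size H * (κ (4 * L) (size H) * (2 * (s + u))) ≤ cnt Z → Step T Z L s u
step {T} {H} free L L≥1 s u s≥1 Z big = record
  { X = proj₁ trimmed
  ; X⊆Z = λ x x∈ → X⊆Z x (∧⁻ˡ (X₁⊆typical x x∈))
  ; ∣X∣ = proj₂ (proj₂ trimmed)
  ; rest = rest }
  where
  open ≤-Reasoning
  -- Markov's inequality is applied twice, on the X side and then on the Y side, and each time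
  -- doubles the fraction of missing edges: 1/(4L) becomes 1/(2L) and then 1/L. Each also halves the
  -- set concerned, hence the 2 in front of `s + u`.
  K = κ (4 * L) (size H)
  M≥1 : 1 ≤ 4 * L
  M≥1 = *-mono-≤ {1} {4} (s≤s z≤n) L≥1
  K≥1 = κ-pos (4 * L) M≥1 (size H)
  open DensePair (dense-pair {T} {H} free (4 * L) M≥1 (K * (2 * (s + u)))
    (*-mono-≤ K≥1 (*-mono-≤ {1} {2} (s≤s z≤n) (≤-trans s≥1 (m≤m+n s u)))) Z big)
  ne = nonEdge T
  typical : VPred (size T)
  typical = X ∩ (λ x → deg ne Y x * (4 * L) ≤ᵇ 2 * cnt Y)
  half : ∀ {P P′ : VPred (size T)} → K * (2 * (s + u)) ≤ K * cnt P → cnt P ≤ 2 * cnt P′ → s + u ≤ cnt P′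
  half p q = *-cancelˡ-≤ 2 (≤-trans (*-cancelˡ-≤ K {{>-nonZero K≥1}} p) q)
  trimmed = prefix s typical (≤-trans (m≤m+n s u) (half {X} {typical} X-large (markov X (deg ne Y) (4 * L) (cnt Y) dense)))
  X₁⊆typical = proj₁ (proj₂ trimmed)
  rest : ∀ S → S ⊆ᵇ proj₁ trimmed → Σ (VPred (size T)) λ Y′ → Y′ ⊆ᵇ Z × Disj (proj₁ trimmed) Y′ × u ≤ cnt Y′ ×
         (∀ S′ → S′ ⊆ᵇ Y′ → pairs ne S S′ * L ≤ cnt S * cnt S′)
  rest S S⊆ = Y′ , (λ y → Y⊆Z y ∘ ∧⁻ˡ) , (λ x p q → disjoint x (∧⁻ˡ (X₁⊆typical x p)) (∧⁻ˡ q)) ,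
      ≤-trans (m≤n+m u s) (half {Y} {Y′} Y-large (markov Y (deg (flip ne) S) (4 * L) (2 * cnt S) avg)) , λ S′ sub → begin
        pairs ne S S′ * L               ≡⟨ cong (_* L) (pairs-flip ne S S′) ⟩
        pairs (flip ne) S′ S * L        ≤⟨ pairs-bound (flip ne) S′ S L (cnt S) (λ y y∈ → low y (sub y y∈)) ⟩
        cnt S′ * cnt S                  ≡⟨ *-comm (cnt S′) _ ⟩
        cnt S * cnt S′                  ∎
    where
    Y′ : VPred (size T)
    Y′ = Y ∩ (λ y → deg (flip ne) S y * (4 * L) ≤ᵇ 2 * (2 * cnt S))
    avg : pairs (flip ne) Y S * (4 * L) ≤ cnt Y * (2 * cnt S)
    avg = begin
      pairs (flip ne) Y S * (4 * L)   ≡⟨ cong (_* (4 * L)) (pairs-flip ne S Y) ⟨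
      pairs ne S Y * (4 * L)          ≤⟨ pairs-bound ne S Y (4 * L) (2 * cnt Y) (λ x x∈ →
                                           ≤ᵇ⇒≤ _ _ (∧⁻ʳ {X x} (X₁⊆typical x (S⊆ x x∈)))) ⟩
      cnt S * (2 * cnt Y)             ≡⟨ arith (cnt S) (cnt Y) ⟩
      cnt Y * (2 * cnt S)             ∎
      where
      arith : ∀ x y → x * (2 * y) ≡ y * (2 * x)
      arith = solve-∀
    low : ∀ y → y ∈ᵇ Y′ → deg (flip ne) S y * L ≤ cnt S
    low y y∈ = *-cancelˡ-≤ 4 (begin
      4 * (deg (flip ne) S y * L)     ≡⟨ arith (deg (flip ne) S y) L ⟩
      deg (flip ne) S y * (4 * L)     ≤⟨ ≤ᵇ⇒≤ _ _ (∧⁻ʳ {Y y} y∈) ⟩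
      2 * (2 * cnt S)                 ≡⟨ *-assoc 2 2 (cnt S) ⟨
      4 * cnt S                       ∎)
      where
      arith : ∀ x y → 4 * (x * y) ≡ x * (4 * y)
      arith = solve-∀

Choice : Tour → Set₁
Choice T = ℕ → VPred (size T) → (ℕ → VPred (size T)) → Set

-- The hosts `Xs` are kept beside the chosen `Ss`: being disjoint and of equal size s, they control
-- the size of their union, however small the `Ss` are.
record DenseSequence (T : Tour) (Z : VPred (size T)) (Good : Choice T) (L s m : ℕ) : Set where
  field
    Xs Ss    : ℕ → VPred (size T)
    parts    : ℕ → ℕ → VPred (size T)
    X⊆Z      : ∀ p → p < m → Xs p ⊆ᵇ Z
    ∣X∣      : ∀ p → p < m → cnt (Xs p) ≡ s
    S⊆X      : ∀ p → p < m → Ss p ⊆ᵇ Xs p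
    good     : ∀ p → p < m → Good p (Ss p) (parts p)
    disjoint : ∀ p r → p < r → r < m → Disj (Xs p) (Xs r)
    dense    : ∀ p r → p < r → r < m → pairs (nonEdge T) (Ss p) (Ss r) * L ≤ cnt (Ss p) * cnt (Ss r)

-- Room needed for m rounds, in units of s. The recursion is the requirement of `step` with u =
-- `γ L h m * s` reserved for the remaining rounds.
γ : ℕ → ℕ → ℕ → ℕ
γ L h zero    = 0
γ L h (suc m) = h * (κ (4 * L) h * (2 * (1 + γ L h m)))

dense-sequence : ∀ {T H} → ¬ Contains T H → ∀ L → 1 ≤ L → ∀ s → 1 ≤ s → ∀ m (Good : Choice T) →
                 (∀ p → p < m → ∀ X → cnt X ≡ s → ∃₂ λ S P → S ⊆ᵇ X × Good p S P) →
                 ∀ Z → γ L (size H) m * s ≤ cnt Z → DenseSequence T Z Good L s m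
dense-sequence free L L≥1 s s≥1 zero Good pick Z big = record
  { Xs = λ _ _ → false ; Ss = λ _ _ → false ; parts = λ _ _ _ → false
  ; X⊆Z = λ _ () ; ∣X∣ = λ _ () ; S⊆X = λ _ () ; good = λ _ ()
  ; disjoint = λ _ _ _ () ; dense = λ _ _ _ () }
dense-sequence {T} {H} free L L≥1 s s≥1 (suc m) Good pick Z big = record
  { Xs = Xs ; Ss = Ss ; parts = parts
  ; X⊆Z = λ { zero _ → St.X⊆Z ; (suc p) p<m x → Y⊆Z x ∘ R.X⊆Z p (s<s⁻¹ p<m) x }
  ; ∣X∣ = λ { zero _ → St.∣X∣ ; (suc p) p<m → R.∣X∣ p (s<s⁻¹ p<m) }
  ; S⊆X = λ { zero _ → S⊆X₀ ; (suc p) p<m → R.S⊆X p (s<s⁻¹ p<m) }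
  ; good = λ { zero _ → good₀ ; (suc p) p<m → R.good p (s<s⁻¹ p<m) }
  ; disjoint = λ { zero (suc r) _ r<m x p q → apart x p (R.X⊆Z r (s<s⁻¹ r<m) x q)
                 ; (suc p) (suc r) p<r r<m → R.disjoint p r (s<s⁻¹ p<r) (s<s⁻¹ r<m) }
  -- All later sets lie in the set left over by the first round, whose bound holds for each of its
  -- subsets; this covers every pair with the first set at once.
  ; dense = λ { zero (suc r) _ r<m → dense₀ _ (λ x → R.X⊆Z r (s<s⁻¹ r<m) x ∘ R.S⊆X r (s<s⁻¹ r<m) x)
              ; (suc p) (suc r) p<r r<m → R.dense p r (s<s⁻¹ p<r) (s<s⁻¹ r<m) } }
  where
  h = size H
  arith : ∀ h k g s → h * (k * (2 * (1 + g))) * s ≡ h * (k * (2 * (s + g * s)))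
  arith = solve-∀
  module St = Step (step {T} {H} free L L≥1 s (γ L h m * s) s≥1 Z
    (≤-trans (≤-reflexive (sym (arith h (κ (4 * L) h) (γ L h m) s))) big))
  picked = pick 0 (s≤s z≤n) St.X St.∣X∣
  S₀ = proj₁ picked
  S⊆X₀ = proj₁ (proj₂ (proj₂ picked))
  good₀ = proj₂ (proj₂ (proj₂ picked))
  rest = St.rest S₀ S⊆X₀
  Y⊆Z = proj₁ (proj₂ rest)
  apart = proj₁ (proj₂ (proj₂ rest))
  dense₀ = proj₂ (proj₂ (proj₂ (proj₂ rest)))
  module R = DenseSequence (dense-sequence {T} {H} free L L≥1 s s≥1 m (Good ∘ suc) (λ p p<m → pick (suc p) (s≤s p<m)) (proj₁ rest)
    (proj₁ (proj₂ (proj₂ (proj₂ rest)))))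
  Xs Ss : ℕ → VPred (size T)
  Xs zero    = St.X
  Xs (suc p) = R.Xs p
  Ss zero    = S₀
  Ss (suc p) = R.Ss p
  parts : ℕ → ℕ → VPred (size T)
  parts zero    = proj₁ (proj₂ picked)
  parts (suc p) = R.parts p

-- Rational scaling and a root estimate

toℚᵘ-ℕ→ℚ : ∀ n → toℚᵘ (ℕ→ℚ n) ≡ mkℚᵘ (ℤ.+ n) 0
toℚᵘ-ℕ→ℚ n = cong toℚᵘ (ℚ.normalize-coprime {n} {0} (C.sym (C.1-coprimeTo n)))

toℚᵘ-scale : ∀ c k d → toℚᵘ c ≃ᵘ mkℚᵘ (ℤ.+ k) d → ∀ x →
             toℚᵘ (c ℚ.* ℕ→ℚ x) ≃ᵘ mkℚᵘ (ℤ.+ k) d ℚᵘ.* mkℚᵘ (ℤ.+ x) 0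
toℚᵘ-scale c k d eq x = ℚᵘ.≃-trans (ℚ.toℚᵘ-homo-* c (ℕ→ℚ x))
  (ℚᵘ.*-cong eq (ℚᵘ.≃-reflexive (toℚᵘ-ℕ→ℚ x)))

-- With c recognised as k/(d + 1), a rational size condition becomes an inequality of natural
-- numbers.
scale-≤⁺ : ∀ c k d → toℚᵘ c ≃ᵘ mkℚᵘ (ℤ.+ k) d → ∀ x y → k * x ≤ suc d * y → c ℚ.* ℕ→ℚ x ℚ.≤ ℕ→ℚ y
scale-≤⁺ c k d eq x y le = ℚ.toℚᵘ-cancel-≤ (ℚᵘ.≤-respˡ-≃ (ℚᵘ.≃-sym (toℚᵘ-scale c k d eq x))
  (subst (mkℚᵘ (ℤ.+ k) d ℚᵘ.* mkℚᵘ (ℤ.+ x) 0 ℚᵘ.≤_) (sym (toℚᵘ-ℕ→ℚ y)) (*≤ᵘ* ineq)))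
  where
  ineq : ℤ.+ k ℤ.* ℤ.+ x ℤ.* ℤ.+ 1 ℤ.≤ ℤ.+ y ℤ.* ℤ.+ (suc (d * 1))
  ineq = subst₂ ℤ._≤_ (trans (ℤ.pos-* k x) (sym (ℤ.*-identityʳ _)))
    (trans (cong ℤ.+_ (trans (*-comm (suc d) y) (cong (λ e → y * suc e) (sym (*-identityʳ d))))) (ℤ.pos-* y _)) (+≤+ le)

scale-≤⁻ : ∀ c k d → toℚᵘ c ≃ᵘ mkℚᵘ (ℤ.+ k) d → ∀ x y → c ℚ.* ℕ→ℚ x ℚ.≤ ℕ→ℚ y → k * x ≤ suc d * y
scale-≤⁻ c k d eq x y le with ℚᵘ.≤-respˡ-≃ (toℚᵘ-scale c k d eq x)
  (subst (toℚᵘ (c ℚ.* ℕ→ℚ x) ℚᵘ.≤_) (toℚᵘ-ℕ→ℚ y) (ℚ.toℚᵘ-mono-≤ le))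
... | *≤ᵘ* ineq = ℤ.drop‿+≤+ (subst₂ ℤ._≤_ (sym (trans (ℤ.pos-* k x) (sym (ℤ.*-identityʳ _))))
    (sym (trans (cong ℤ.+_ (trans (*-comm (suc d) y) (cong (λ e → y * suc e) (sym (*-identityʳ d))))) (ℤ.pos-* y _))) ineq)

-- Index shift: 1/ d is the rational number 1 / (d + 1).
1/ : ℕ → ℚ
1/ d = mkℚ (ℤ.+ 1) d (C.1-coprimeTo (suc d))

1/-pos : ∀ d → 0ℚ ℚ.< 1/ d
1/-pos d = *<* (+<+ (s≤s z≤n))

1/-<1 : ∀ d → 1/ (suc d) ℚ.< 1ℚ
1/-<1 d = *<* (+<+ (s≤s (s≤s z≤n)))

scale-1/-≤⁺ : ∀ d {x y} → x ≤ suc d * y → 1/ d ℚ.* ℕ→ℚ x ℚ.≤ ℕ→ℚ y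
scale-1/-≤⁺ d {x} {y} le = scale-≤⁺ (1/ d) 1 d ℚᵘ.≃-refl x y (≤-trans (≤-reflexive (*-identityˡ x)) le)

scale-1-1/-≤⁺ : ∀ d {x y} → d * x ≤ suc d * y → (1ℚ ℚ.- 1/ d) ℚ.* ℕ→ℚ x ℚ.≤ ℕ→ℚ y
scale-1-1/-≤⁺ d {x} {y} = scale-≤⁺ (1ℚ ℚ.- 1/ d) d d
  (ℚᵘ.≃-trans (ℚ.toℚᵘ-homo-+ 1ℚ (ℚ.- 1/ d)) (*≡ᵘ* (trans
    (cong (λ e → ℤ.+ e ℤ.* ℤ.+ suc d) (+-identityʳ d))
    (cong (λ e → ℤ.+ d ℤ.* ℤ.+ suc e) (sym (+-identityʳ d)))))) x y

-- The witness is 1/(d + 2) and not 1/(d + 1): it will serve as λ, which must stay strictly below 1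
-- even when λ₀ does not.
1/-below : ∀ c → 0ℚ ℚ.< c → ∃ λ d → 1/ (suc d) ℚ.≤ c
1/-below (mkℚ +[1+ k ] d _) _ = d , *≤* (+≤+ (*-mono-≤ {1} {suc k} (s≤s z≤n) (n≤1+n (suc d))))
1/-below (mkℚ (ℤ.+ 0) d _) (*<* (+<+ ()))
1/-below (mkℚ ℤ.-[1+ _ ] d _) (*<* ())

scale-bound : ∀ c → 0ℚ ℚ.< c → ∃ λ d → ∀ x y → c ℚ.* ℕ→ℚ x ℚ.≤ ℕ→ℚ y → x ≤ suc d * y
scale-bound c@(mkℚ +[1+ k ] d _) _ = d , λ x y le →
  ≤-trans (m≤n*m x (suc k)) (scale-≤⁻ c (suc k) d ℚᵘ.≃-refl x y le)
scale-bound (mkℚ (ℤ.+ 0) d _) (*<* (+<+ ()))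
scale-bound (mkℚ ℤ.-[1+ _ ] d _) (*<* ())

^-distribʳ-* : ∀ q m n → (m * n) ^ q ≡ m ^ q * n ^ q
^-distribʳ-* zero    m n = refl
^-distribʳ-* (suc q) m n = trans (cong (m * n *_) (^-distribʳ-* q m n)) (arith m n (m ^ q) (n ^ q))
  where
  arith : ∀ m n a b → m * n * (a * b) ≡ m * a * (n * b)
  arith = solve-∀

-- This is (1 + 1/d)^q ≥ 1 + q/d multiplied by d^(q+1).
bernoulli : ∀ d q → d ^ q * (d + q) ≤ d * suc d ^ q
bernoulli d zero    = ≤-reflexive (arith d)
  where
  arith : ∀ d → 1 * (d + 0) ≡ d * 1
  arith = solve-∀
bernoulli d (suc q) = begin
  d * d ^ q * (d + suc q)               ≡⟨ arith₁ d (d ^ q) q ⟩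
  d * (d ^ q * (d + q)) + d ^ q * d
                                                ≤⟨ +-monoʳ-≤ _ (*-monoʳ-≤ (d ^ q) (m≤m+n d q)) ⟩
  d * (d ^ q * (d + q)) + d ^ q * (d + q)
                                                ≡⟨ +-comm _ (d ^ q * (d + q)) ⟩
  suc d * (d ^ q * (d + q))             ≤⟨ *-monoʳ-≤ (suc d) (bernoulli d q) ⟩
  suc d * (d * suc d ^ q)                 ≡⟨ arith₂ (suc d) d (suc d ^ q) ⟩
  d * (suc d * suc d ^ q)                 ∎
  where
  open ≤-Reasoning
  arith₁ : ∀ d p q → d * p * (d + suc q) ≡ d * (p * (d + q)) + p * d
  arith₁ = solve-∀
  arith₂ : ∀ a b c → a * (b * c) ≡ b * (a * c)
  arith₂ = solve-∀

-- For q ≥ d E we have E d^q ≤ (d + 1)^q, so a loss of a factor E in the sizes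
-- costs only a factor d / (d + 1) in the q-th roots.
root-gap : ∀ d E q → 1 ≤ d → d * E ≤ q → ∀ t r → t ^ q < E * r ^ q → d * t < suc d * r
root-gap d E q d≥1 dE≤q t r lt = ≰⇒> λ le → n≮n (d ^ q * t ^ q) (begin-strict
  d ^ q * t ^ q              <⟨ *-monoʳ-< (d ^ q) {{d^q≢0}} lt ⟩
  d ^ q * (E * r ^ q)      ≡⟨ *-assoc (d ^ q) E (r ^ q) ⟨
  d ^ q * E * r ^ q        ≤⟨ *-monoˡ-≤ (r ^ q) gap ⟩
  suc d ^ q * r ^ q          ≡⟨ ^-distribʳ-* q (suc d) r ⟨
  (suc d * r) ^ q              ≤⟨ ^-monoˡ-≤ q le ⟩
  (d * t) ^ q                  ≡⟨ ^-distribʳ-* q d t ⟩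
  d ^ q * t ^ q              ∎)
  where
  open ≤-Reasoning
  instance
    d≢0 = >-nonZero d≥1
  d^q≢0 = m^n≢0 d q
  arith : ∀ d p E → d * (p * E) ≡ p * (d * E)
  arith = solve-∀
  gap : d ^ q * E ≤ suc d ^ q
  gap = *-cancelˡ-≤ d (begin
    d * (d ^ q * E)          ≡⟨ arith d (d ^ q) E ⟩
    d ^ q * (d * E)          ≤⟨ *-monoʳ-≤ (d ^ q) (≤-trans dE≤q (m≤n+m q d)) ⟩
    d ^ q * (d + q)          ≤⟨ bernoulli d q ⟩
    d * suc d ^ q              ∎)

-- From dense sequences to m-sequences

record Blocks (T : Tour) (t e : ℕ) (S : VPred (size T)) (part : ℕ → VPred (size T)) : Set where
  field
    xs       : List (V T)
    ordered  : AllPairs (Edge T) xs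
    S⊆xs     : S ⊆ᵇ ofList xs
    cover    : ∀ x → x ∈ᵇ S → ∃ λ a → InRange e a × x ∈ᵇ part a
    part⊆S   : ∀ a → InRange e a → part a ⊆ᵇ S
    disjoint : ∀ a b → InRange e a → InRange e b → a ≢ b → Disj (part a) (part b)
    complete : ∀ a b → InRange e a → InRange e b → a < b →
               ∀ x y → x ∈ᵇ part a → y ∈ᵇ part b → Edge T x y
    large    : ∀ a → InRange e a → t ≤ 4 * e * cnt (part a)

-- The blocks are e consecutive runs of w = ⌊r/e⌋ vertices, numbered from 1, and the last r mod e
-- vertices are left out of `S`. As e ≤ r, w is positive and the remainder is at most we, so r ≤
-- 2we; together with t ≤ 2r this is the factor 4e in `large`.
blocks-of-chain : ∀ {T X r t e} → Chain T X r → t ≤ 2 * r → 2 * e ≤ t → 1 ≤ e →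
                  ∃₂ λ S part → S ⊆ᵇ X × Blocks T t e S part
blocks-of-chain {T} {X} {_} {t} {e} (chain xs refl m ord) t≤2r 2e≤t e≥1 = S , part , S⊆X , record
  { xs = xs ; ordered = ord
  ; S⊆xs = λ x x∈ → let i , _ , eq = toWitness x∈ in fromWitness (i , eq)
  ; cover = λ x x∈ → let i , i< , eq = toWitness x∈ in
      suc (toℕ i / w) , (s≤s z≤n , m<n*o⇒m/o<n i<) , fromWitness (i , refl , i< , eq)
  ; part⊆S = λ a _ x x∈ → let i , _ , i< , eq = toWitness x∈ in fromWitness (i , i< , eq)
  ; disjoint = λ a b _ _ a≢b x x∈ x∈′ →
      let i , ia , _ , eq = toWitness x∈ ; j , jb , _ , eq′ = toWitness x∈′ in
      a≢b (trans (sym ia) (trans (cong (λ k → suc (toℕ k / w)) (lookup-injective {T} ord (trans eq (sym eq′)))) jb))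
  ; complete = λ a b _ _ a<b x y x∈ y∈ →
      let i , ia , _ , eq = toWitness x∈ ; j , jb , _ , eq′ = toWitness y∈ in
      subst₂ (Edge T) eq eq′ (lookup-edge {T} ord (≰⇒> λ j≤i →
        <⇒≱ a<b (subst₂ _≤_ jb ia (s≤s (/-monoˡ-≤ w j≤i)))))
  ; large = large }
  where
  open ≤-Reasoning
  r = length xs
  instance
    e≢0 : NonZero e
    e≢0 = >-nonZero e≥1
  w = r / e
  e≤r : e ≤ r
  e≤r = *-cancelˡ-≤ 2 (≤-trans 2e≤t t≤2r)
  instance
    w≢0 : NonZero w
    w≢0 = >-nonZero (m≥n⇒m/n>0 e≤r)
  S? : ∀ x (i : Fin r) → Dec (toℕ i < e * w × lookup xs i ≡ x)
  S? x i = toℕ i <? e * w ×-dec lookup xs i Fin.≟ x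
  S : VPred (size T)
  S x = isYes (any? (S? x))
  part : ℕ → VPred (size T)
  part a x = isYes (any? λ i → suc (toℕ i / w) ≟ a ×-dec S? x i)
  S⊆X : S ⊆ᵇ X
  S⊆X x x∈ = let i , _ , eq = toWitness x∈ in subst (_∈ᵇ X) eq (All.lookup m (∈-lookup i))
  large : ∀ a → InRange e a → t ≤ 4 * e * cnt (part a)
  large (suc a) (_ , a<e) = begin
    t                          ≤⟨ t≤2r ⟩
    2 * r                      ≡⟨ cong (2 *_) (m≡m%n+[m/n]*n r e) ⟩
    2 * (r % e + w * e)        ≤⟨ *-monoʳ-≤ 2 (+-monoˡ-≤ (w * e) (≤-trans (<⇒≤ (m%n<n r e)) (m≤n*m e w))) ⟩
    2 * (w * e + w * e)        ≡⟨ arith w e ⟩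
    4 * e * w                  ≤⟨ *-monoʳ-≤ (4 * e) (injection⇒≤cnt f f-inj f∈) ⟩
    4 * e * cnt (part (suc a)) ∎
    where
    arith : ∀ w e → 2 * (w * e + w * e) ≡ 4 * e * w
    arith = solve-∀
    bound : ∀ (j : Fin w) → toℕ j + a * w < e * w
    bound j = ≤-trans (+-monoˡ-≤ (a * w) (toℕ<n j)) (*-monoˡ-≤ w a<e)
    ew≤r : e * w ≤ r
    ew≤r = ≤-trans (≤-reflexive (*-comm e w)) (m/n*n≤m r e)
    idx : Fin w → Fin r
    idx j = Fin.fromℕ< (<-≤-trans (bound j) ew≤r)
    idx-toℕ : ∀ j → toℕ (idx j) ≡ toℕ j + a * w
    idx-toℕ j = toℕ-fromℕ< _
    f : Fin w → V T
    f = lookup xs ∘ idx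
    f-inj : Injective _≡_ _≡_ f
    f-inj {i} {j} eq = toℕ-injective (+-cancelʳ-≡ (a * w) _ _
      (trans (sym (idx-toℕ i)) (trans (cong toℕ (lookup-injective {T} ord eq)) (idx-toℕ j))))
    f∈ : ∀ j → f j ∈ᵇ part (suc a)
    f∈ j = fromWitness {a? = any? λ i → suc (toℕ i / w) ≟ suc a ×-dec S? (f j) i}
      (idx j , cong suc quotient , subst (_< e * w) (sym (idx-toℕ j)) (bound j) , refl)
      where
      quotient : toℕ (idx j) / w ≡ a
      quotient = trans (cong (_/ w) (idx-toℕ j)) (trans (+-distrib-/-∣ʳ (toℕ j) (n∣m*n a))
        (cong₂ _+_ (m<n⇒m/n≡0 (toℕ<n j)) (m*n/n≡m a w)))

-- Edge counts and restriction to an induced subtournament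

listSum-allFin : ∀ {n} (f : Fin n → ℕ) → ListAction.sum (List.map f (allFin n)) ≡ sum f
listSum-allFin f = trans (cong ListAction.sum (map-tabulate id f)) (go f)
  where
  go : ∀ {n} (f : Fin n → ℕ) → ListAction.sum (List.tabulate f) ≡ sum f
  go {zero}  f = sym (sum-empty f)
  go {suc n} f = trans (cong (f zero +_) (go (f ∘ suc))) (sym (sum-suc f))

eCount≡pairs : ∀ T X Y → eCount T X Y ≡ pairs (adj T) (Vec.lookup X) (Vec.lookup Y)
eCount≡pairs T X Y = trans (listSum-allFin _) (trans (sum-cong λ x → trans (listSum-allFin _)
  (sum-cong λ y → pointwise (Vec.lookup X x) (Vec.lookup Y y) (adj T x y)))
  (sym (pairs′ (adj T) (Vec.lookup X) (Vec.lookup Y))))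
  where
  pointwise : ∀ a b c → (if a ∧ b ∧ c then 1 else 0) ≡ 𝟙 a * (𝟙 b * 𝟙 c)
  pointwise false _ _ = refl
  pointwise true false _ = refl
  pointwise true true false = refl
  pointwise true true true = refl

eCount-full : ∀ T X Y → eCount T X Y ≡ ∣ X ∣ * ∣ Y ∣ →
              ∀ x y → x ∈ᵇ Vec.lookup X → y ∈ᵇ Vec.lookup Y → Edge T x y
eCount-full T X Y eq = pairs-full⇒all (adj T) (Vec.lookup X) (Vec.lookup Y)
  (trans (sym (eCount≡pairs T X Y)) (trans eq (cong₂ _*_ (∣∣≡cnt X) (∣∣≡cnt Y))))

restrict : ∀ {n} (W : VPred n) → VPred n → Vec.Vec Bool (cnt W)
restrict W P = subsetOf (P ∘ enum W)

∣restrict∣ : ∀ {n} {W P : VPred n} → P ⊆ᵇ W → ∣ restrict W P ∣ ≡ cnt P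
∣restrict∣ {W = W} {P} sub = trans (∣subsetOf∣ (P ∘ enum W)) (cnt-enum sub)

eCount-restrict : ∀ T W {P Q} → P ⊆ᵇ W → Q ⊆ᵇ W →
                  eCount (sub T W) (restrict W P) (restrict W Q) ≡ pairs (adj T) P Q
eCount-restrict T W {P} {Q} p q = begin
  eCount (sub T W) (restrict W P) (restrict W Q)          ≡⟨ eCount≡pairs (sub T W) (restrict W P) (restrict W Q) ⟩
  pairs (adj (sub T W)) (Vec.lookup (restrict W P)) (Vec.lookup (restrict W Q))
                                                          ≡⟨ cong-pairs ⟩
  pairs (adj (sub T W)) (P ∘ enum W) (Q ∘ enum W)         ≡⟨ pairs-enum W (adj T) p q ⟩
  pairs (adj T) P Q                                       ∎
  where
  open ≡-Reasoning
  cong-pairs : pairs (adj (sub T W)) (Vec.lookup (restrict W P)) (Vec.lookup (restrict W Q)) ≡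
               pairs (adj (sub T W)) (P ∘ enum W) (Q ∘ enum W)
  cong-pairs = sum-cong λ x → cong₂ _*_ (cong 𝟙 (lookup∘tabulate (P ∘ enum W) x))
    (sum-cong λ y → cong (λ b → 𝟙 (b ∧ adj (sub T W) x y)) (lookup∘tabulate (Q ∘ enum W) y))

-- Positions are counted from 0, so that entry p is S_{p+1}.
Required : (T : Tour) (s t : ℕ) (v : ℕ → Bool) (η : ℕ → ℕ) → Choice T
Required T s t v η p S part =
  (v (suc p) ≡ false → cnt S ≡ s) × (v (suc p) ≡ true → Blocks T t (η (ζ v (suc p))) S part)

module _ {T : Tour} {v : ℕ → Bool} {η : ℕ → ℕ} {Z : VPred (size T)} {l s t t′ m : ℕ}
         (σ : DenseSequence T Z (Required T s t v η) (suc l) s m) where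
  open DenseSequence σ

  W : VPred (size T)
  W x = isYes (any? λ (p : Fin m) → T? (Xs (toℕ p) x))

  X⊆W : ∀ p → p < m → Xs p ⊆ᵇ W
  X⊆W p p<m x x∈ = fromWitness (Fin.fromℕ< p<m , subst (λ q → x ∈ᵇ Xs q) (sym (toℕ-fromℕ< p<m)) x∈)

  cnt-W : cnt W ≤ m * s
  cnt-W = ≤-trans (cnt-union (λ p → Xs (toℕ p)) λ x → toWitness)
    (sum-bound λ p → ≤-reflexive (∣X∣ (toℕ p) (toℕ<n p)))

  -- The size constant sees only m and η: the m hosts of size s cover the whole subtournament, and a
  -- block has at least t/(4η) vertices with t′ ≤ t. The density parameter enters through `l` alone.
  toMSeq : ∀ k → m ≤ suc k → (∀ p → p < m → 4 * η (ζ v (suc p)) ≤ suc k) → t′ ≤ t →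
           MSeq (sub T W) t′ m v η (1/ k) (1/ l)
  toMSeq k m≤ η≤ t′≤t = record
    { S = λ i → restrict W (Ss (pred i))
    ; part = λ i a → restrict W (parts (pred i) a)
    ; disjoint = λ { (suc p) (suc r) (_ , p<m) (_ , r<m) p≢r x x∈ x∈′ →
        apart p r p<m r<m (p≢r ∘ cong suc) (∈-subsetOf⁻ x∈) (∈-subsetOf⁻ x∈′) }
    ; one-transitive = λ { (suc p) (_ , p<m) vp (n , x , mem , _ , step , back) →
        let open Blocks (chosen p p<m vp) in
        chain-acyclic {T} ordered n (enum W ∘ x) (λ i i≤n → S⊆xs _ (∈-subsetOf⁻ (mem i i≤n))) step back }
    ; one-cover₁ = λ { (suc p) (_ , p<m) vp x x∈ →
        let a , a∈ , x∈a = Blocks.cover (chosen p p<m vp) _ (∈-subsetOf⁻ x∈) in a , a∈ , ∈-subsetOf⁺ x∈a }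
    ; one-cover₂ = λ { (suc p) (_ , p<m) vp a a∈ x x∈ →
        ∈-subsetOf⁺ (Blocks.part⊆S (chosen p p<m vp) a a∈ _ (∈-subsetOf⁻ x∈)) }
    ; one-partsDisjoint = λ { (suc p) (_ , p<m) vp a b a∈ b∈ a≢b x x∈ x∈′ →
        Blocks.disjoint (chosen p p<m vp) a b a∈ b∈ a≢b _ (∈-subsetOf⁻ x∈) (∈-subsetOf⁻ x∈′) }
    ; one-complete = λ { (suc p) (_ , p<m) vp a b a∈ b∈ a<b x y x∈ y∈ →
        Blocks.complete (chosen p p<m vp) a b a∈ b∈ a<b _ _ (∈-subsetOf⁻ x∈) (∈-subsetOf⁻ y∈) }
    ; one-size = λ { (suc p) (_ , p<m) vp a a∈ → scale-1/-≤⁺ k (begin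
        t′                                        ≤⟨ t′≤t ⟩
        t                                         ≤⟨ Blocks.large (chosen p p<m vp) a a∈ ⟩
        4 * η (ζ v (suc p)) * cnt (parts p a)     ≤⟨ *-monoˡ-≤ _ (η≤ p p<m) ⟩
        suc k * cnt (parts p a)                   ≡⟨ cong (suc k *_) (∣restrict∣ (λ x →
                                                       S⊆W p p<m x ∘ Blocks.part⊆S (chosen p p<m vp) a a∈ x)) ⟨
        suc k * ∣ restrict W (parts p a) ∣        ∎) }
    ; zero-size = λ { (suc p) (_ , p<m) vp → scale-1/-≤⁺ k (begin
        cnt W                                     ≤⟨ cnt-W ⟩
        m * s                                     ≤⟨ *-monoˡ-≤ s m≤ ⟩
        suc k * s                                 ≡⟨ cong (suc k *_) (proj₁ (good p p<m) vp) ⟨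
        suc k * cnt (Ss p)                        ≡⟨ cong (suc k *_) (∣restrict∣ (S⊆W p p<m)) ⟨
        suc k * ∣ restrict W (Ss p) ∣             ∎) }
    ; dense = λ { (suc p) (suc r) (_ , p<m) (_ , r<m) p<r → scale-1-1/-≤⁺ l (begin
        l * (∣ restrict W (Ss p) ∣ * ∣ restrict W (Ss r) ∣)
                          ≡⟨ cong (l *_) (cong₂ _*_ (∣restrict∣ (S⊆W p p<m)) (∣restrict∣ (S⊆W r r<m))) ⟩
        l * (cnt (Ss p) * cnt (Ss r))             ≤⟨ density (pairs-complement (adj T) (Ss p) (Ss r))
                                                       (DenseSequence.dense σ p r (s<s⁻¹ p<r) r<m) ⟩
        suc l * pairs (adj T) (Ss p) (Ss r)       ≡⟨ cong (suc l *_) (eCount-restrict T W (S⊆W p p<m) (S⊆W r r<m)) ⟨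
        suc l * eCount (sub T W) (restrict W (Ss p)) (restrict W (Ss r)) ∎) }
    }
    where
    open ≤-Reasoning
    S⊆W : ∀ p → p < m → Ss p ⊆ᵇ W
    S⊆W p p<m x = X⊆W p p<m x ∘ S⊆X p p<m x
    chosen = λ p p<m → proj₂ (good p p<m)
    apart : ∀ p r → p < m → r < m → p ≢ r → ∀ {x} → x ∈ᵇ Ss p → x ∈ᵇ Ss r → ⊥
    apart p r p<m r<m p≢r {x} x∈ x∈′ with <-cmp p r
    ... | tri< p<r _ _ = DenseSequence.disjoint σ p r p<r r<m x (S⊆X p p<m x x∈) (S⊆X r r<m x x∈′)
    ... | tri≈ _ p≡r _ = p≢r p≡r
    ... | tri> _ _ r<p = DenseSequence.disjoint σ r p r<p p<m x (S⊆X r r<m x x∈′) (S⊆X p p<m x x∈)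
    density : ∀ {a b c} → a + b ≡ c → b * suc l ≤ c → l * c ≤ suc l * a
    density {a} {b} {c} eq le = +-cancelʳ-≤ c _ _ (begin
      l * c + c                  ≡⟨ +-comm (l * c) c ⟩
      suc l * c                  ≡⟨ cong (suc l *_) eq ⟨
      suc l * (a + b)            ≡⟨ *-distribˡ-+ (suc l) a b ⟩
      suc l * a + suc l * b      ≡⟨ cong (suc l * a +_) (*-comm (suc l) b) ⟩
      suc l * a + b * suc l      ≤⟨ +-monoʳ-≤ (suc l * a) le ⟩
      suc l * a + c              ∎)

-- The extremal argument

sumTo-mono : ∀ f {i j} → i ≤ j → sumTo f i ≤ sumTo f j
sumTo-mono f {i} {zero}  z≤n = z≤n
sumTo-mono f {i} {suc j} i≤1+j with m≤n⇒m<n∨m≡n i≤1+j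
... | inj₁ i<1+j = ≤-trans (sumTo-mono f (s≤s⁻¹ i<1+j)) (m≤m+n _ _)
... | inj₂ refl  = ≤-refl

term≤sumTo : ∀ f {p m} → p < m → f (suc p) ≤ sumTo f m
term≤sumTo f {p} p<m = ≤-trans (m≤n+m (f (suc p)) (sumTo f p)) (sumTo-mono f p<m)

ζ-inRange : ∀ v {p m} → p < m → v (suc p) ≡ true → InRange (ζ v m) (ζ v (suc p))
ζ-inRange v {p} p<m vp =
  ≤-trans (≤-reflexive (cong (if_then 1 else 0) (sym vp))) (m≤n+m _ (ζ v p)) , sumTo-mono _ p<m

n<2^n : ∀ n → n < 2 ^ n
n<2^n zero    = s≤s z≤n
n<2^n (suc n) = ≤-trans (+-mono-≤ (m^n>0 2 n) (n<2^n n)) (≤-reflexive (cong (2 ^ n +_) (sym (+-identityʳ (2 ^ n)))))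

n≤2^n : ∀ n → n ≤ 2 ^ n
n≤2^n n = <⇒≤ (n<2^n n)

Free : ∀ {nH} → (Fin nH → Tour) → Tour → Set
Free H T = ∀ i → ¬ Contains T (H i)

free-sub : ∀ {nH} (H : Fin nH → Tour) T P → Free H T → Free H (sub T P)
free-sub H T P free i = free i ∘ contains-sub T P (H i)

-- Two vertices already give a chain of length 2, and 2^q ≥ q exceeds the size; sizes 0 and 1 are
-- treated apart.
small⇒chain : ∀ {T t} → MaxChain T t → ∀ N q → size T < N → N ≤ q → size T ≤ t ^ q
small⇒chain {T} {t} (_ , bound) N q n<N N≤q = go (size T) refl
  where
  open ≤-Reasoning
  cnt-size : cnt (all-vertices {size T}) ≡ size T
  cnt-size = cnt-all (size T)
  go : ∀ n → size T ≡ n → n ≤ t ^ q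
  go zero          eq = z≤n
  go (suc zero)    eq = begin
    1          ≡⟨ ^-zeroˡ q ⟨
    1 ^ q      ≤⟨ ^-monoˡ-≤ q (bound (ramsey 0 all-vertices (≤-reflexive (sym (trans cnt-size eq))))) ⟩
    t ^ q      ∎
  go (suc (suc n)) eq = begin
    suc (suc n)  ≡⟨ eq ⟨
    size T       ≤⟨ <⇒≤ (<-≤-trans n<N N≤q) ⟩
    q            ≤⟨ n≤2^n q ⟩
    2 ^ q        ≤⟨ ^-monoˡ-≤ q (bound (ramsey 1 all-vertices (≤-trans (s≤s (s≤s z≤n)) (≤-reflexive (sym (trans cnt-size eq)))))) ⟩
    t ^ q        ∎

-- The constants and the critical tournament

module Extraction {nH : ℕ} (H : Fin nH → Tour) (i₀ : Fin nH) (m′ : ℕ) (v : ℕ → Bool) (η : ℕ → ℕ)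
  (η≥1 : ∀ j → InRange (ζ v (suc m′)) j → 1 ≤ η j) where

  open ≤-Reasoning

  m = suc m′

  Ση : ℕ
  Ση = sumTo (λ i → η (ζ v i)) m

  η≤Ση : ∀ p → p < m → η (ζ v (suc p)) ≤ Ση
  η≤Ση p = term≤sumTo (λ i → η (ζ v i))

  -- Dominates m and four times each block count, as `toMSeq` demands, and is known before λ₀ and c₂
  -- are.
  k : ℕ
  k = m + 4 * Ση

  module Constants (F : (i : Fin nH) → V (H i) → ℕ) (l d₂ : ℕ) (c₂ : ℚ)
    (c₂-bound : ∀ x y → c₂ ℚ.* ℕ→ℚ x ℚ.≤ ℕ→ℚ y → x ≤ suc d₂ * y)
    (alternative : ∀ T t → IsTr T t → (χ : MSeq T t m v η (1/ k) (1/ l)) →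
                   HasRainbowCopy χ nH H F ⊎ StrongPair χ c₂) where

    -- The hosts have size s = ⌊n/G⌋: the γ in `G` is the room for the dense sequence, and the 2
    -- makes s < n, so that the induction hypothesis applies to them. Since n ≤ 2Gs, a set of at
    -- least s/(d₂ + 1) vertices has at least n/E. With d + 1 = 2(d₂ + 1), a fraction 1/(d₂ + 1) of
    -- tr(T′) ≥ t/2 is at least t/(d + 1). From n ≥ N follow s ≥ 1 and, by `ramsey`, t > 2Ση. In q,
    -- `d * E` serves `root-gap` and `N` serves the tournaments with fewer than N vertices.
    L G E d N q : ℕ
    L  = suc l
    G  = 2 + γ L (size (H i₀)) m
    E  = 2 * G * suc d₂
    d  = suc (2 * d₂)
    N  = G + 2 ^ (2 * Ση)
    q  = d * E + N

    module Critical (T : Tour) (free : Free H T)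
      (IH : ∀ U → size U < size T → Free H U → ∃ λ r → Chain U all-vertices r × size U ≤ r ^ q)
      {t : ℕ} (max : MaxChain T t) (t^q<n : t ^ q < size T) (N≤n : N ≤ size T) where

      n = size T

      opaque
        -- U stands for T or T′, but sizes are always measured against n = |T|. The induction
        -- hypothesis for U[P] gives t^q < n ≤ E|P| ≤ E r^q, and `root-gap` takes the root.
        long-chain : ∀ U P → Free H U → cnt P < n → n ≤ E * cnt P → ∃ λ r → Chain U P r × d * t < suc d * r
        long-chain U P freeU lt le =
          let r , c , b = IH (sub U P) lt (free-sub H U P freeU) in
          r , chain-lift (λ i _ → enum-∈ P i) c , root-gap d E q (s≤s z≤n) (m≤m+n (d * E) N) t r (begin-strict
            t ^ q          <⟨ t^q<n ⟩
            n              ≤⟨ le ⟩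
            E * cnt P      ≤⟨ *-monoʳ-≤ E b ⟩
            E * r ^ q      ∎)

      t≤dt : t ≤ d * t
      t≤dt = m≤n*m t d

      halved : ∀ r → d * t < suc d * r → t ≤ 2 * r
      halved r lt = *-cancelˡ-≤ (suc d) (begin
        suc d * t            ≤⟨ +-monoˡ-≤ (d * t) t≤dt ⟩
        d * t + d * t        ≤⟨ +-mono-≤ (<⇒≤ lt) (<⇒≤ lt) ⟩
        suc d * r + suc d * r ≡⟨ arith (suc d) r ⟩
        suc d * (2 * r)      ∎)
        where
        arith : ∀ a b → a * b + a * b ≡ a * (2 * b)
        arith = solve-∀

      t>2Ση : 2 * Ση < t
      t>2Ση = proj₂ max (ramsey (2 * Ση) all-vertices
        (≤-trans (m≤n+m _ G) (≤-trans N≤n (≤-reflexive (sym (cnt-all n))))))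

      s : ℕ
      s = n / G

      s≥1 : 1 ≤ s
      s≥1 = m≥n⇒m/n>0 (≤-trans (m≤m+n G _) N≤n)

      sG≤n : s * G ≤ n
      sG≤n = m/n*n≤m n G

      s<n : s < n
      s<n = begin-strict
        s          <⟨ m<m+n s s≥1 ⟩
        s + s      ≡⟨ arith s ⟩
        s * 2      ≤⟨ *-monoʳ-≤ s (m≤m+n 2 _) ⟩
        s * G      ≤⟨ sG≤n ⟩
        n          ∎
        where
        arith : ∀ s → s + s ≡ s * 2
        arith = solve-∀

      n≤2Gs : n ≤ 2 * G * s
      n≤2Gs = begin
        n                  ≡⟨ m≡m%n+[m/n]*n n G ⟩
        n % G + s * G      ≤⟨ +-monoˡ-≤ (s * G) (≤-trans (<⇒≤ (m%n<n n G)) (m≤n*m G s {{>-nonZero s≥1}})) ⟩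
        s * G + s * G      ≡⟨ arith s G ⟩
        2 * G * s          ∎
        where
        arith : ∀ s G → s * G + s * G ≡ 2 * G * s
        arith = solve-∀

      linear : ∀ {a} → s ≤ suc d₂ * a → n ≤ E * a
      linear {a} le = begin
        n                         ≤⟨ n≤2Gs ⟩
        2 * G * s                 ≤⟨ *-monoʳ-≤ (2 * G) le ⟩
        2 * G * (suc d₂ * a)      ≡⟨ *-assoc (2 * G) (suc d₂) a ⟨
        E * a                     ∎

      n≤Es : n ≤ E * s
      n≤Es = linear (m≤n*m s (suc d₂))

      pick : ∀ p → p < m → ∀ X → cnt X ≡ s → ∃₂ λ S P → S ⊆ᵇ X × Required T s t v η p S P
      pick p p<m X ∣X∣≡s = choose (v (suc p)) refl
        where
        choose : ∀ b → v (suc p) ≡ b → ∃₂ λ S P → S ⊆ᵇ X × Required T s t v η p S P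
        choose false vp = X , (λ _ _ → false) , (λ _ → id) , (λ _ → ∣X∣≡s) , λ vp′ → case trans (sym vp) vp′ of λ ()
        choose true vp =
          let r , c , gap = long-chain T X free (subst (_< n) (sym ∣X∣≡s) s<n) (subst (λ c → n ≤ E * c) (sym ∣X∣≡s) n≤Es)
              S , P , S⊆X , blocks = blocks-of-chain {t = t} {e = η (ζ v (suc p))} c (halved r gap)
                (≤-trans (*-monoʳ-≤ 2 (η≤Ση p p<m)) (<⇒≤ t>2Ση)) (η≥1 _ (ζ-inRange v p<m vp))
          in S , P , S⊆X , (λ vp′ → case trans (sym vp) vp′ of λ ()) , λ _ → blocks

      opaque
        σ : DenseSequence T all-vertices (Required T s t v η) L s m
        σ = dense-sequence {T} {H i₀} (free i₀) L (s≤s z≤n) s s≥1 m (Required T s t v η) pick all-vertices (begin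
          γ L (size (H i₀)) m * s      ≤⟨ *-monoˡ-≤ s (m≤n+m (γ L (size (H i₀)) m) 2) ⟩
          G * s                        ≡⟨ *-comm G s ⟩
          s * G                        ≤⟨ sG≤n ⟩
          n                            ≡⟨ cnt-all n ⟨
          cnt all-vertices             ∎)

      Wσ : VPred n
      Wσ = W {v = v} {η} {t = t} {t′ = t} σ

      T′ : Tour
      T′ = sub T Wσ

      free′ : Free H T′
      free′ = free-sub H T Wσ free

      t′ = proj₁ (max-chain T′)
      max′ = proj₂ (max-chain T′)

      t′≤t : t′ ≤ t
      t′≤t = proj₂ max (chain-lift (λ _ _ → _) (proj₁ max′))

      X₀⊆W = X⊆W {v = v} {η} {t = t} {t′ = t} σ 0 (s≤s z≤n)

      s≤∣T′∣ : s ≤ size T′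
      s≤∣T′∣ = ≤-trans (≤-reflexive (sym (DenseSequence.∣X∣ σ 0 (s≤s z≤n)))) (cnt-mono X₀⊆W)

      -- A strong pair measures a transitive B by tr(T′), so tr(T′) must not fall far below tr(T).
      -- One host inside T′ is already linear in T and carries a chain of length at least t/2.
      t≤2t′ : t ≤ 2 * t′
      t≤2t′ = ≤-trans (halved (proj₁ found) (proj₂ (proj₂ found)))
                      (*-monoʳ-≤ 2 (proj₂ max′ (chain-⊆ (λ _ _ → _) (proj₁ (proj₂ found)))))
        where
        X₀ : VPred (size T′)
        X₀ = DenseSequence.Xs σ 0 ∘ enum Wσ
        ∣X₀∣ : cnt X₀ ≡ s
        ∣X₀∣ = trans (cnt-enum X₀⊆W) (DenseSequence.∣X∣ σ 0 (s≤s z≤n))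
        found = long-chain T′ X₀ free′ (subst (_< n) (sym ∣X₀∣) s<n) (subst (λ c → n ≤ E * c) (sym ∣X₀∣) n≤Es)

      t′≥1 : 1 ≤ t′
      t′≥1 = n≢0⇒n>0 λ t′≡0 → n≮n 0 (begin-strict
        0         ≤⟨ z≤n ⟩
        2 * Ση    <⟨ t>2Ση ⟩
        t         ≤⟨ t≤2t′ ⟩
        2 * t′    ≡⟨ cong (2 *_) t′≡0 ⟩
        0         ∎)

      χ : MSeq T′ t′ m v η (1/ k) (1/ l)
      χ = toMSeq σ k (≤-trans (m≤m+n m _) (n≤1+n k))
        (λ p p<m → ≤-trans (*-monoʳ-≤ 4 (η≤Ση p p<m)) (≤-trans (m≤n+m _ m) (n≤1+n k))) t′≤t

      pos : ∀ {c a} → 1 ≤ c → c ≤ suc d₂ * a → 1 ≤ a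
      pos {a = zero}  c≥1 le = ⊥-elim (n≮n 0 (≤-trans c≥1 (≤-trans le (≤-reflexive (*-zeroʳ (suc d₂))))))
      pos {a = suc a} _   _  = s≤s z≤n

      -- The bounds dt < (d + 1)a and t ≤ (d + 1)b add up to t < a + b, while the concatenated
      -- chains lie in T′, where t′ ≤ t is the maximum.
      no-strong-pair : ¬ StrongPair χ c₂
      no-strong-pair (A , B , _ , _ , disj , A-large , B-large , full) =
        n≮n (suc d * t) (begin-strict
          suc d * t              ≡⟨ +-comm t (d * t) ⟩
          d * t + t              <⟨ +-mono-<-≤ (proj₂ (proj₂ chain-A)) (proj₁ (proj₂ (proj₂ B-side))) ⟩
          suc d * a + suc d * b  ≡⟨ *-distribˡ-+ (suc d) a b ⟨
          suc d * (a + b)        ≤⟨ *-monoʳ-≤ (suc d) (≤-trans (join full) t′≤t) ⟩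
          suc d * t              ∎)
        where
        PA PB : VPred (size T′)
        PA = Vec.lookup A
        PB = Vec.lookup B
        bound : ∀ x (C : VSet T′) → c₂ ℚ.* ℕ→ℚ x ℚ.≤ ℕ→ℚ ∣ C ∣ → x ≤ suc d₂ * cnt (Vec.lookup C)
        bound x C le = ≤-trans (c₂-bound x ∣ C ∣ le) (≤-reflexive (cong (suc d₂ *_) (∣∣≡cnt C)))
        A-big : s ≤ suc d₂ * cnt PA
        A-big = ≤-trans s≤∣T′∣ (bound (size T′) A A-large)
        sizes : cnt PA + cnt PB ≤ n
        sizes = begin
          cnt PA + cnt PB              ≤⟨ cnt-disjoint {R = all-vertices} (λ _ _ → _) (λ _ _ → _)
                                            (λ x p r → disj x (∈ᵇ-lookup⁻ p) (∈ᵇ-lookup⁻ r)) ⟩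
          cnt {size T′} all-vertices   ≡⟨ cnt-all (size T′) ⟩
          cnt Wσ                       ≤⟨ cnt≤n Wσ ⟩
          n                            ∎
        A≥1 : 1 ≤ cnt PA
        A≥1 = pos s≥1 A-big
        B-side : ∃ λ b → Chain T′ PB b × t ≤ suc d * b × 1 ≤ cnt PB
        B-side = reduce (map⊎ large transitive B-large)
          where
          large : c₂ ℚ.* ℕ→ℚ (size T′) ℚ.≤ ℕ→ℚ ∣ B ∣ → ∃ λ b → Chain T′ PB b × t ≤ suc d * b × 1 ≤ cnt PB
          large le =
            let B-big = ≤-trans s≤∣T′∣ (bound (size T′) B le)
                b , c , gap = long-chain T′ PB free′ (<-≤-trans (m<n+m (cnt PB) A≥1) sizes) (linear B-big)
            in b , c , ≤-trans t≤dt (<⇒≤ gap) , pos s≥1 B-big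
          -- Here B may be far too small for the induction hypothesis; it is itself the chain, of
          -- length at least t/(d + 1).
          transitive : Transitive T′ B × c₂ ℚ.* ℕ→ℚ t′ ℚ.≤ ℕ→ℚ ∣ B ∣ →
                       ∃ λ b → Chain T′ PB b × t ≤ suc d * b × 1 ≤ cnt PB
          transitive (tr , le) = cnt PB , subst (Chain T′ PB) (∣∣≡cnt B) (transitive⇒chain T′ {B} tr) , (begin
              t                          ≤⟨ t≤2t′ ⟩
              2 * t′                     ≤⟨ *-monoʳ-≤ 2 (bound t′ B le) ⟩
              2 * (suc d₂ * cnt PB)      ≡⟨ arith d₂ (cnt PB) ⟩
              suc d * cnt PB             ∎) , pos t′≥1 (bound t′ B le)
            where
            arith : ∀ x y → 2 * (suc x * y) ≡ suc (suc (2 * x)) * y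
            arith = solve-∀
        -- That B is nonempty and disjoint from A gives |A| < n, which the induction hypothesis
        -- requires.
        chain-A = long-chain T′ PA free′
          (<-≤-trans (m<m+n (cnt PA) (proj₂ (proj₂ (proj₂ B-side)))) sizes) (linear A-big)
        a = proj₁ chain-A
        b = proj₁ B-side
        join : eCount T′ A B ≡ ∣ A ∣ * ∣ B ∣ ⊎ eCount T′ B A ≡ ∣ B ∣ * ∣ A ∣ → a + b ≤ t′
        join (inj₁ eq) = proj₂ max′ (chain-++ (eCount-full T′ A B eq) (proj₁ (proj₂ chain-A)) (proj₁ (proj₂ B-side)))
        join (inj₂ eq) = ≤-trans (≤-reflexive (+-comm a b))
          (proj₂ max′ (chain-++ (eCount-full T′ B A eq) (proj₁ (proj₂ B-side)) (proj₁ (proj₂ chain-A))))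

      absurd : ⊥
      absurd = reduce (map⊎ (λ (i , x , _ , inj , hom) → free′ i (x , inj , hom)) no-strong-pair
        (alternative T′ t′ (max-chain⇒IsTr max′) χ))

    -- Strong induction on the size. Deciding both comparisons leaves the critical case only for a
    -- large tournament that violates the bound, and `Critical` refutes it.
    polynomial-chain : ∀ bound T → size T < bound → Free H T → ∃ λ r → Chain T all-vertices r × size T ≤ r ^ q
    polynomial-chain (suc bound) T (s≤s n≤bound) free with max-chain T
    ... | t , max with size T ≤? t ^ q | N ≤? size T
    ...   | yes le | _ = t , proj₁ max , le
    ...   | no _ | no small = t , proj₁ max , small⇒chain max N q (≰⇒> small) (m≤n+m N (d * E))
    ...   | no large | yes N≤n = ⊥-elim (Critical.absurd T free
            (λ U lt → polynomial-chain bound U (<-≤-trans lt n≤bound)) max (≰⇒> large) N≤n)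

    eh : EH nH H
    eh = 1 , q , s≤s z≤n , ≤-trans (s≤s z≤n) (m≤n+m N (d * E)) , λ T free →
      let r , c , le = polynomial-chain (suc (size T)) T ≤-refl free
          S , tr , r≤S = chain⇒transitive c
      in S , tr , ≤-trans (≤-reflexive (*-identityʳ (size T))) (≤-trans le (^-monoˡ-≤ q r≤S))

theorem6 : (nH : ℕ) (H : Fin nH → Tour) → 1 ≤ nH →
    (m : ℕ) (v : ℕ → Bool) (η : ℕ → ℕ) →
    (∀ j → InRange (ζ v m) j → 1 ≤ η j) →
    (F : (i : Fin nH) → V (H i) → ℕ) →
    (∀ i → Injective _≡_ _≡_ (F i)) →
    (∀ i h → InRange (kOf m v η) (F i h)) →
    StrongEH nH H F m v η → EH nH H
-- For m = 0 there are no parts, so k = 0 and every member of the family has no vertices; it embeds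
-- in every tournament, and none is free.
theorem6 nH H nH≥1 zero v η η≥1 F F-inj F-range strong = 1 , 1 , s≤s z≤n , s≤s z≤n , λ T free →
  ⊥-elim (free i₀ ((λ h → ⊥-elim (empty h)) , (λ {h} → ⊥-elim (empty h)) , λ h → ⊥-elim (empty h)))
  where
  i₀ = Fin.fromℕ< nH≥1
  empty : V (H i₀) → ⊥
  empty h = let ge , le = F-range i₀ h in n≮n 0 (≤-trans ge le)
theorem6 nH H nH≥1 (suc m) v η η≥1 F F-inj F-range strong =
  let lam₀ , c₂ , lam₀>0 , c₂>0 , alternative = strong (1/ k) (1/-pos k)
      l , 1/l≤lam₀ = 1/-below lam₀ lam₀>0
      d₂ , c₂-bound = scale-bound c₂ c₂>0
  in Constants.eh F (suc l) d₂ c₂ c₂-bound λ T t tr →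
       alternative T t tr (1/ (suc l)) (ℚ.<⇒≤ (1/-pos (suc l))) 1/l≤lam₀ (1/-<1 l)
  where open Extraction H (Fin.fromℕ< nH≥1) m v η η≥1
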